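{- Suppose that there is an algorithm computing the max-plus convolution of two monotone non-decreasing sequences $A,B\in\{0,1,\dots,M\}^n$ in time $T_2(n,M)$, and assume that $T_2(n,M)$ is monotone in $n$. Then there also is an algorithm computing the max-plus convolution of a monotone non-decreasing sequence $A\in\{0,1,\dots,M\}^n$ and an arbitrary (i.e., not necessarily monotone) sequence $B\in\{0,1,\dots,M\}^n$ in time $T_1(n,M)$ which satisfies the recurrence $$T_1(n,M)\le 2\,T_1(n/2,M)+O(T_2(n,M)).$$ The same statement holds with "non-decreasing" replaced by "non-increasing" (throughout), or with "max-plus" replaced by "min-plus" (throughout), or both.
   Context: For sequences $A=A[0\ldots n-1]$ and $B=B[0\ldots n-1]$ of integers, the max-plus convolution is the sequence $C[0\ldots 2n-2]$ with $C[k]=\max_{i+j=k}(A[i]+B[j])$, the maximum ranging over $0\le i,j<n$ with $i+j=k$; the min-plus convolution is defined with $\min$ in place of $\max$. Running times are in the standard RAM model. -}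

module Defs where

open import Data.Bool.Base using (if_then_else_)
open import Data.Fin.Base as Fin using (Fin; toℕ)
open import Data.List.Base using (List; []; _∷_)
open import Data.Maybe.Base using (Maybe; just; nothing)
open import Data.Nat.Base
  using (ℕ; zero; suc; _+_; _*_; _∸_; _/_; _^_; _≤_; _<_; _≥_)
open import Data.Nat.Properties using (_≟_)
open import Data.Product.Base using (_×_; ∃-syntax; ∃₂)
open import Data.Vec.Functional using (Vector)
open import Relation.Binary.Core using (_Preserves_⟶_)
open import Relation.Binary.PropositionalEquality.Core using (_≡_)
open import Relation.Nullary.Decidable.Core using (⌊_⌋)

------------------------------------------------------------------------
-- Convolutions

data Extremum : Set where
  max-plus min-plus : Extremum

Dominates : Extremum → ℕ → ℕ → Set
Dominates max-plus x y = y ≤ x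
Dominates min-plus x y = x ≤ y

-- C k is the maximum (respectively minimum) of the finite set
-- { A i + B j | i + j = k }: it belongs to the set and dominates it.
IsConvolution : Extremum → ∀ {n} →
  Vector ℕ n → Vector ℕ n → Vector ℕ (2 * n ∸ 1) → Set
IsConvolution o A B C = ∀ k →
  (∃₂ λ i j → toℕ i + toℕ j ≡ toℕ k × A i + B j ≡ C k) ×
  (∀ i j → toℕ i + toℕ j ≡ toℕ k → Dominates o (C k) (A i + B j))

data Direction : Set where
  non-decreasing non-increasing : Direction

Monotone : Direction → ∀ {n} → Vector ℕ n → Set
Monotone non-decreasing A = A Preserves Fin._≤_ ⟶ _≤_
Monotone non-increasing A = A Preserves Fin._≤_ ⟶ _≥_

------------------------------------------------------------------------
-- Random access machines
--
-- A unit-cost RAM whose words are natural numbers.  Registers can only be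
-- named by instructions, so a program uses finitely many of them; the
-- memory is addressed indirectly, through the contents of a register.

data Op : Set where
  add sub mul div : Op

-- Subtraction is truncated and division by zero yields zero.
⟦_⟧ : Op → ℕ → ℕ → ℕ
⟦ add ⟧ x y       = x + y
⟦ sub ⟧ x y       = x ∸ y
⟦ mul ⟧ x y       = x * y
⟦ div ⟧ x zero    = 0
⟦ div ⟧ x (suc y) = x / suc y

data Instr : Set where
  const : (r c : ℕ) → Instr               -- r ← c
  arith : (o : Op) (r x y : ℕ) → Instr    -- r ← x o y
  load  : (r x : ℕ) → Instr               -- r ← memory[x]
  store : (x y : ℕ) → Instr               -- memory[x] ← y
  jump  : (l : ℕ) → Instr                 -- goto l
  jzero : (x l : ℕ) → Instr               -- if x = 0 goto l

Program : Set
Program = List Instr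

record State : Set where
  constructor ⟨_,_,_⟩
  field
    pc  : ℕ
    reg : ℕ → ℕ
    mem : ℕ → ℕ

open State public

_[_≔_] : (ℕ → ℕ) → ℕ → ℕ → (ℕ → ℕ)
(f [ a ≔ v ]) b = if ⌊ b ≟ a ⌋ then v else f b

exec : Instr → State → State
exec (const r c)     ⟨ p , R , H ⟩ = ⟨ suc p , R [ r ≔ c ] , H ⟩
exec (arith o r x y) ⟨ p , R , H ⟩ = ⟨ suc p , R [ r ≔ ⟦ o ⟧ (R x) (R y) ] , H ⟩
exec (load r x)      ⟨ p , R , H ⟩ = ⟨ suc p , R [ r ≔ H (R x) ] , H ⟩
exec (store x y)     ⟨ p , R , H ⟩ = ⟨ suc p , R , H [ R x ≔ R y ] ⟩
exec (jump l)        ⟨ p , R , H ⟩ = ⟨ l , R , H ⟩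
exec (jzero x l)     ⟨ p , R , H ⟩ with R x
... | zero  = ⟨ l , R , H ⟩
... | suc _ = ⟨ suc p , R , H ⟩

fetch : Program → ℕ → Maybe Instr
fetch []      _       = nothing
fetch (ι ∷ _) zero    = just ι
fetch (_ ∷ P) (suc p) = fetch P p

Fits : ℕ → State → Set
Fits W s = (∀ r → reg s r < W) × (∀ a → mem s a < W)

-- Run P W s t s′: started in s, the program P halts in s′ after exactly t
-- steps, and every word occurring on the way is smaller than W.  A program
-- halts when its program counter leaves the instruction list.
data Run (P : Program) (W : ℕ) : State → ℕ → State → Set where
  halt : ∀ {s} → Fits W s → fetch P (pc s) ≡ nothing → Run P W s 0 s
  step : ∀ {s ι t s′} → Fits W s → fetch P (pc s) ≡ just ι →
         Run P W (exec ι s) t s′ → Run P W s (suc t) s′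

------------------------------------------------------------------------
-- Algorithms for convolution

-- Register 0 holds n and register 1 holds M; A and B occupy the memory
-- cells 0, …, n - 1 and n, …, 2n - 1; everything else is zero.
record Input {n} (M : ℕ) (A B : Vector ℕ n) (s : State) : Set where
  field
    pc-start : pc s ≡ 0
    reg-n    : reg s 0 ≡ n
    reg-M    : reg s 1 ≡ M
    reg-rest : ∀ r → 2 ≤ r → reg s r ≡ 0
    mem-A    : ∀ i → mem s (toℕ i) ≡ A i
    mem-B    : ∀ j → mem s (n + toℕ j) ≡ B j
    mem-rest : ∀ a → 2 * n ≤ a → mem s a ≡ 0

-- C is left in the memory cells 2n, …, 4n - 2.
output : ∀ n → State → Vector ℕ (2 * n ∸ 1)
output n s k = mem s (2 * n + toℕ k)

-- P computes the convolution of all A, B ∈ {0, …, M}ⁿ satisfying the promise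
-- in time T n M.  As usual for the RAM, words have O(log (n + M)) bits, i.e.
-- stay below a fixed power of n + M + 2; without such a bound, unit-cost
-- multiplication would be unreasonably powerful.
ComputesInTime : Extremum → (∀ {n} → Vector ℕ n → Vector ℕ n → Set) →
  (ℕ → ℕ → ℕ) → Program → Set
ComputesInTime o Promise T P =
  ∃[ w ] ∀ {n} M (A B : Vector ℕ n) → 1 ≤ n →
    (∀ i → A i ≤ M) → (∀ j → B j ≤ M) → Promise A B →
    ∀ s → Input M A B s →
    ∃₂ λ t s′ → Run P ((n + M + 2) ^ w) s t s′ × t ≤ T n M ×
      IsConvolution o A B (output n s′)

{-# OPTIONS --safe #-}
module Submission where

-- Reverse the indices, if necessary, so that A increases towards the extremum.
-- Then B may be replaced by its prefix optima as long as i does not run past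
-- the end of A: an earlier j comes with a later, hence at least as good, i.  One
-- call of the subroutine on the last m entries of A and the prefix optima of a
-- window of B starting at β thus yields valid candidates for m entries of C and
-- settles all pairs (i , j) in the window with (i - (n - m)) + (j - β) < m.
-- On the levels m = n, ⌈n/2⌉, ⌈⌈n/2⌉/2⌉, … , 2 the windows start at the
-- multiples of h = ⌈m/2⌉, which settles the pairs with n - m ≤ i < n - h; the
-- pairs with i = n - 1 are settled directly.  Level d = 0, 1, … calls the
-- subroutine at most 2^(d+1) times, as in the unrolled recurrence.
--
-- Linear overhead is paid for by T₂: for M ≥ 1 a subroutine has to write 2m - 1
-- nonzero outputs.

open import Algebra.Properties.CommutativeSemigroup using (interchange)
open import Data.Bool.Base using (Bool; true; false; T)
open import Data.Fin.Base using (Fin; toℕ; fromℕ<)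
open import Data.Fin.Properties using (toℕ-fromℕ<; toℕ<n)
open import Data.List.Base using (List; []; _∷_; _++_; length; map; concatMap; replicate)
open import Data.List.Properties using (length-++)
open import Data.Maybe.Base using (just; nothing)
open import Data.Nat.Base
open import Data.Nat.DivMod using (m/n≤m; m/n≡1+[m∸n]/n)
open import Data.Nat.ListAction using (sum)
open import Data.Nat.Properties
open import Data.Nat.Tactic.RingSolver using (solve-∀)
open import Data.Product.Base using (_×_; _,_; ∃; ∃-syntax; ∃₂; proj₁; proj₂)
open import Data.Sum.Base using (_⊎_; inj₁; inj₂)
open import Data.Unit.Base using (⊤; tt)
open import Data.Vec.Functional using (Vector)
open import Function.Base using (_∘_)
open import Relation.Binary.PropositionalEquality
open import Relation.Nullary.Decidable.Core using (yes; no)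
open import Relation.Nullary.Negation.Core using (contradiction)
open import Defs

-- The machine has no call stack, so the recursion runs level by level; a budget `q`, doubled from
-- level to level, lets the loops be charged to the recurrence. The main obstacle is that the
-- subroutine expects zeroed memory while its addresses range up to a power of `n + M + 2`, so
-- clearing that range could cost far more than the call itself. Its values are therefore stored
-- shifted by an epoch, which grows by `V` per call. At most `n` levels of at most `n` windows keep
-- the epoch within `n * (n * V)`, and this product dictates the word size of the resulting program.

Store : Set
Store = ℕ → ℕ

≔-same : ∀ (f : Store) a {v} → (f [ a ≔ v ]) a ≡ v
≔-same f a with a ≟ a
... | yes _  = refl
... | no a≢a = contradiction refl a≢a

≔-other : ∀ (f : Store) {a b v} → b ≢ a → (f [ a ≔ v ]) b ≡ f b
≔-other f {a} {b} b≢a with b ≟ a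
... | yes b≡a = contradiction b≡a b≢a
... | no _    = refl

≔-elim : ∀ (P : ℕ → ℕ → Set) (f : Store) a {v} →
  P a v → (∀ b → b ≢ a → P b (f b)) → ∀ b → P b ((f [ a ≔ v ]) b)
≔-elim P f a Pv Pf b with b ≟ a
... | yes refl = Pv
... | no b≢a   = Pf b b≢a

-- Index reversal and extrema

mirror : Bool → ℕ → ℕ → ℕ
mirror false t i = i
mirror true  t i = t ∸ i

mirror-≤ : ∀ ρ {t i} → i ≤ t → mirror ρ t i ≤ t
mirror-≤ false     i≤t = i≤t
mirror-≤ true {t} {i} i≤t = m∸n≤m t i

mirror-involutive : ∀ ρ {t i} → i ≤ t → mirror ρ t (mirror ρ t i) ≡ i
mirror-involutive false i≤t = refl
mirror-involutive true  i≤t = m∸[m∸n]≡n i≤t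

mirror-injective : ∀ ρ {t i j} → i ≤ t → j ≤ t → mirror ρ t i ≡ mirror ρ t j → i ≡ j
mirror-injective ρ {t} i≤t j≤t eq =
  trans (sym (mirror-involutive ρ i≤t)) (trans (cong (mirror ρ t) eq) (mirror-involutive ρ j≤t))

-- Reversing both inputs reverses their convolution about the sum of the two end points, so one
-- program text parametrised by `ρ` serves both orientations.
mirror-+ : ∀ ρ {s t i j} → i ≤ s → j ≤ t →
  mirror ρ s i + mirror ρ t j ≡ mirror ρ (s + t) (i + j)
mirror-+ false i≤s j≤t = refl
mirror-+ true {s} {t} {i} {j} i≤s j≤t = begin
  (s ∸ i) + (t ∸ j) ≡⟨ +-∸-assoc (s ∸ i) j≤t ⟨
  (s ∸ i) + t ∸ j   ≡⟨ cong (_∸ j) (+-∸-comm t i≤s) ⟨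
  (s + t ∸ i) ∸ j   ≡⟨ ∸-+-assoc (s + t) i j ⟩
  s + t ∸ (i + j)   ∎
  where open ≡-Reasoning

-- Truncated subtraction yields optima without a branch: the maximum is `x + (y ∸ x)` and the
-- minimum is `x ∸ (x ∸ y)`. `gap` and `join` are the two instructions of this computation.
gap : Extremum → ℕ → ℕ → ℕ
gap max-plus x y = y ∸ x
gap min-plus x y = x ∸ y

join : Extremum → ℕ → ℕ → ℕ
join max-plus = _+_
join min-plus = _∸_

best : Extremum → ℕ → ℕ → ℕ
best o x y = join o x (gap o x y)

dom-refl : ∀ o {x} → Dominates o x x
dom-refl max-plus = ≤-refl
dom-refl min-plus = ≤-refl

dom-trans : ∀ o {x y z} → Dominates o x y → Dominates o y z → Dominates o x z
dom-trans max-plus y≤x z≤y = ≤-trans z≤y y≤x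
dom-trans min-plus x≤y y≤z = ≤-trans x≤y y≤z

dom-antisym : ∀ o {x y} → Dominates o x y → Dominates o y x → x ≡ y
dom-antisym max-plus y≤x x≤y = ≤-antisym x≤y y≤x
dom-antisym min-plus x≤y y≤x = ≤-antisym x≤y y≤x

dom-+ : ∀ o {x y u v} → Dominates o x y → Dominates o u v → Dominates o (x + u) (y + v)
dom-+ max-plus = +-mono-≤
dom-+ min-plus = +-mono-≤

best-cases : ∀ o x y →
  (best o x y ≡ x × Dominates o x y) ⊎ (best o x y ≡ y × Dominates o y x)
best-cases max-plus x y with ≤-total y x
... | inj₁ y≤x = inj₁ (trans (cong (x +_) (m≤n⇒m∸n≡0 y≤x)) (+-identityʳ x) , y≤x)
... | inj₂ x≤y = inj₂ (m+[n∸m]≡n x≤y , x≤y)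
best-cases min-plus x y with ≤-total x y
... | inj₁ x≤y = inj₁ (cong (x ∸_) (m≤n⇒m∸n≡0 x≤y) , x≤y)
... | inj₂ y≤x = inj₂ (m∸[m∸n]≡n y≤x , y≤x)

best-elim : ∀ o {x y} (P : ℕ → Set) → P x → P y → P (best o x y)
best-elim o {x} {y} P Px Py with best-cases o x y
... | inj₁ (eq , _) = subst P (sym eq) Px
... | inj₂ (eq , _) = subst P (sym eq) Py

best-domˡ : ∀ o x y → Dominates o (best o x y) x
best-domˡ o x y with best-cases o x y
... | inj₁ (eq , _)   rewrite eq = dom-refl o
... | inj₂ (eq , y≽x) rewrite eq = y≽x

best-domʳ : ∀ o x y → Dominates o (best o x y) y
best-domʳ o x y with best-cases o x y
... | inj₁ (eq , x≽y) rewrite eq = x≽y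
... | inj₂ (eq , _)   rewrite eq = dom-refl o

-- Relocatable code and its timed Hoare logic

-- The argument is the load address, which is needed because jump targets are absolute.
Code : Set
Code = ℕ → Program

infixr 5 _⨾_

_⨾_ : Code → Code → Code
(c ⨾ d) l = c l ++ d (l + length (c l))

while : ℕ → Code → Code
-- The exit target lies just past the closing `jump`: one instruction for the test, then the body,
-- then one instruction for the jump back.
while x c l = jzero x (suc (suc l + length (c (suc l)))) ∷ c (suc l) ++ jump l ∷ []

record Placed (Q : Program) (l : ℕ) (P : Program) : Set where
  constructor placed
  field
    at : ∀ {p ι} → fetch P p ≡ just ι → fetch Q (l + p) ≡ just ι

open Placed public

fetch-++ˡ : ∀ P {P′ p ι} → fetch P p ≡ just ι → fetch (P ++ P′) p ≡ just ι
fetch-++ˡ (_ ∷ P) {p = zero}  eq = eq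
fetch-++ˡ (_ ∷ P) {p = suc p} eq = fetch-++ˡ P eq

fetch-++ʳ : ∀ P {P′} p → fetch (P ++ P′) (length P + p) ≡ fetch P′ p
fetch-++ʳ []      p = refl
fetch-++ʳ (_ ∷ P) p = fetch-++ʳ P p

fetch-length : ∀ P → fetch P (length P) ≡ nothing
fetch-length []      = refl
fetch-length (_ ∷ P) = fetch-length P

fetch-< : ∀ P {p ι} → fetch P p ≡ just ι → p < length P
fetch-< (_ ∷ P) {zero}  eq = z<s
fetch-< (_ ∷ P) {suc p} eq = s<s (fetch-< P eq)

fetch-≥ : ∀ P {p} → fetch P p ≡ nothing → length P ≤ p
fetch-≥ []              eq = z≤n
fetch-≥ (_ ∷ P) {suc p} eq = s≤s (fetch-≥ P eq)

placed-++ˡ : ∀ {Q l} P {P′} → Placed Q l (P ++ P′) → Placed Q l P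
placed-++ˡ P pl .at eq = at pl (fetch-++ˡ P eq)

placed-++ʳ : ∀ {Q l} P {P′} → Placed Q l (P ++ P′) → Placed Q (l + length P) P′
placed-++ʳ {Q} {l} P pl .at {p} eq =
  trans (cong (fetch Q) (+-assoc l (length P) p)) (at pl (trans (fetch-++ʳ P p) eq))

placed-head : ∀ {Q l ι P} → Placed Q l (ι ∷ P) → fetch Q l ≡ just ι
placed-head {Q} {l} pl = trans (cong (fetch Q) (sym (+-identityʳ l))) (at pl {0} refl)

placed-tail : ∀ {Q l ι P} → Placed Q l (ι ∷ P) → Placed Q (suc l) P
placed-tail {Q} {l} pl .at {p} eq = trans (cong (fetch Q) (sym (+-suc l p))) (at pl eq)

-- `Run` without the halting condition, so that executions of fragments can be concatenated.
data Path (Q : Program) (W : ℕ) : State → ℕ → State → Set where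
  []   : ∀ {s} → Path Q W s 0 s
  step : ∀ {s ι t s′} → Fits W s → fetch Q (pc s) ≡ just ι →
         Path Q W (exec ι s) t s′ → Path Q W s (suc t) s′

path-++ : ∀ {Q W s t s′ t′ s″} → Path Q W s t s′ → Path Q W s′ t′ s″ → Path Q W s (t + t′) s″
path-++ []              q = q
path-++ (step fit eq p) q = step fit eq (path-++ p q)

path-run : ∀ {Q W s t s′} → Path Q W s t s′ → Fits W s′ → fetch Q (pc s′) ≡ nothing → Run Q W s t s′
path-run []              fit end = halt fit end
path-run (step fit eq p) fit′ end = step fit eq (path-run p fit′ end)

path-end : ∀ {Q W s t p p′ R H} → p ≡ p′ → Path Q W s t ⟨ p , R , H ⟩ → Path Q W s t ⟨ p′ , R , H ⟩
path-end refl q = q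

exec-jzero-zero : ∀ x l p R H → R x ≡ 0 → exec (jzero x l) ⟨ p , R , H ⟩ ≡ ⟨ l , R , H ⟩
exec-jzero-zero x l p R H eq with R x
exec-jzero-zero x l p R H refl | zero = refl

exec-jzero-suc : ∀ x l p R H → R x ≢ 0 → exec (jzero x l) ⟨ p , R , H ⟩ ≡ ⟨ suc p , R , H ⟩
exec-jzero-suc x l p R H neq with R x
... | zero  = contradiction refl neq
... | suc _ = refl

Assertion : Set₁
Assertion = Store → Store → Set

-- A timed total-correctness judgement. The time and the final stores are chosen before the host
-- program `Q` and the address `l`, hence are independent of them. The program counter `0` inside
-- `Fits` is a dummy, since `Fits` does not inspect it.
record Ends (W : ℕ) (c : Code) (R H : Store) (b : ℕ) (Φ : Assertion) : Set where
  constructor ends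
  field
    run : Fits W ⟨ 0 , R , H ⟩ → ∃[ t ] ∃₂ λ R′ H′ → t ≤ b ×
      (∀ Q l → Placed Q l (c l) →
        Path Q W ⟨ l , R , H ⟩ t ⟨ l + length (c l) , R′ , H′ ⟩) ×
      Fits W ⟨ 0 , R′ , H′ ⟩ × Φ R′ H′

open Ends public

module _ {W : ℕ} where

  weaken : ∀ {c R H b b′ Φ Ψ} → b ≤ b′ → (∀ {R′ H′} → Φ R′ H′ → Ψ R′ H′) →
    Ends W c R H b Φ → Ends W c R H b′ Ψ
  weaken b≤b′ Φ⇒Ψ e .run fit with run e fit
  ... | t , R′ , H′ , t≤b , path , fit′ , φ = t , R′ , H′ , ≤-trans t≤b b≤b′ , path , fit′ , Φ⇒Ψ φ

  -- Continuation style: the postcondition of `c` is the judgement for `d` itself, so that no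
  -- intermediate assertion has to be written down.
  seq : ∀ {c d R H b b′ Φ} → Ends W c R H b (λ R′ H′ → Ends W d R′ H′ b′ Φ) →
    Ends W (c ⨾ d) R H (b + b′) Φ
  seq {c} {d} e .run fit with run e fit
  ... | t , R₁ , H₁ , t≤b , path₁ , fit₁ , e₁ with run e₁ fit₁
  ... | t′ , R₂ , H₂ , t′≤b′ , path₂ , fit₂ , φ =
    t + t′ , R₂ , H₂ , +-mono-≤ t≤b t′≤b′ ,
    (λ Q l pl → path-end
      (trans (+-assoc l _ _) (cong (l +_) (sym (length-++ (c l) {d _}))))
      (path-++ (path₁ Q l (placed-++ˡ (c l) pl)) (path₂ Q _ (placed-++ʳ (c l) pl)))) ,
    fit₂ , φ

  while-zero : ∀ {x c R H} {Φ : Assertion} → R x ≡ 0 → Φ R H → Ends W (while x c) R H 1 Φ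
  while-zero {x} {c} {R} {H} eq φ .run fit = 1 , R , H , ≤-refl ,
    (λ Q l pl → step fit (placed-head pl)
      (subst (λ s → Path Q W s 0 ⟨ l + length (while x c l) , R , H ⟩)
        (sym (trans (exec-jzero-zero x _ l R H eq) (cong (λ p → ⟨ p , R , H ⟩) (end l)))) [])) ,
    fit , φ
    where
    end : ∀ l → suc (suc l + length (c (suc l))) ≡ l + length (while x c l)
    end l rewrite length-++ (c (suc l)) {jump l ∷ []} | +-comm (length (c (suc l))) 1 =
      sym (trans (+-suc l _) (cong suc (+-suc l _)))

  while-suc : ∀ {x c R H b b′ Φ} → R x ≢ 0 →
    Ends W c R H b (λ R′ H′ → Ends W (while x c) R′ H′ b′ Φ) →
    Ends W (while x c) R H (2 + b + b′) Φ
  while-suc {x} {c} {R} {H} {b} {b′} neq e .run fit with run e fit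
  ... | t , R₁ , H₁ , t≤b , path₁ , fit₁ , e₁ with run e₁ fit₁
  ... | t′ , R₂ , H₂ , t′≤b′ , path₂ , fit₂ , φ =
    suc t + suc t′ , R₂ , H₂ ,
    subst (_≤ 2 + b + b′) (cong suc (sym (+-suc t t′))) (s≤s (s≤s (+-mono-≤ t≤b t′≤b′))) ,
    (λ Q l pl → path-++
      (step fit (placed-head pl)
        (subst (λ s → Path Q W s t ⟨ suc l + length (c (suc l)) , R₁ , H₁ ⟩) (sym (exec-jzero-suc x _ l R H neq))
          (path₁ Q (suc l) (placed-++ˡ (c (suc l)) (placed-tail pl)))))
      (step fit₁ (placed-head (placed-++ʳ (c (suc l)) {jump l ∷ []} (placed-tail pl))) (path₂ Q l pl))) ,
    fit₂ , φ

  -- The index of `I` only bounds the number of remaining rounds: the loop may stop early, whence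
  -- the existential `k′`. A round pays 2 for its test and its jump back, and the final failing test
  -- pays 1.
  while-count : ∀ {x c b} (I : ℕ → Assertion) →
    (∀ {R H} → I 0 R H → R x ≡ 0) →
    (∀ {k R H} → I (suc k) R H → R x ≢ 0 → Ends W c R H b (I k)) →
    ∀ k {R H} → I k R H →
    Ends W (while x c) R H (k * (2 + b) + 1) (λ R′ H′ → R′ x ≡ 0 × ∃[ k′ ] I k′ R′ H′)
  while-count {c = c} I stop body zero i = while-zero {c = c} (stop i) (stop i , 0 , i)
  while-count {x} {c} {b} I stop body (suc k) {R} i with R x ≟ 0
  ... | yes eq = weaken (m≤n+m 1 ((2 + b) + k * (2 + b))) (λ φ → φ) (while-zero {c = c} eq (eq , suc k , i))
  ... | no neq = weaken (≤-reflexive (sym (+-assoc (2 + b) (k * (2 + b)) 1))) (λ φ → φ)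
    (while-suc {c = c} neq (weaken {c = c} ≤-refl (while-count I stop body k) (body i neq)))

-- The simulated program uses the registers from 30 on; rT and rU are scratch
-- registers of the translation.
rN rM rOne rE rV rBase rSize rB rI rGo rAcc rX rY rWin : ℕ
rLev rHalf rTop rTop2 rOut rMain rTopm rTopm2 rPOut rPB rOff rLim rT rU : ℕ
rN     = 0
rM     = 1
rOne   = 2
rE     = 3
rV     = 4
rBase  = 5
rSize  = 6
rB     = 7
rI     = 8
rGo    = 9
rAcc   = 10
rX     = 11
rY     = 12
rWin   = 13
rLev   = 14
rHalf  = 15
rTop   = 16
rTop2  = 17
rOut   = 18
rMain  = 19
rTopm  = 20
rTopm2 = 21
rPOut  = 22
rPB    = 23
rOff   = 24
rLim   = 25
rT     = 28
rU     = 29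

-- Straight-line instructions and their weakest preconditions

data Atom : Set where
  set    : (r c : ℕ) → Atom
  bin    : (o : Op) (r x y : ℕ) → Atom
  get    : (r x : ℕ) → Atom
  put    : (x y : ℕ) → Atom
  flip   : (ρ : Bool) (r t i : ℕ) → Atom
  better : (o : Extremum) (r x y : ℕ) → Atom

lower : Atom → List Instr
lower (set r c)            = const r c ∷ []
lower (bin o r x y)        = arith o r x y ∷ []
lower (get r x)            = load r x ∷ []
lower (put x y)            = store x y ∷ []
lower (flip false r t i)   = const rT 0 ∷ arith add r rT i ∷ []
-- The `const` is idle in this case. It leaves the scratch register as in the other case, so that
-- `wp` can treat `flip ρ` without splitting on `ρ`.
lower (flip true r t i)    = const rT 0 ∷ arith sub r t i ∷ []
lower (better max-plus r x y) = arith sub rT y x ∷ arith add r x rT ∷ []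
lower (better min-plus r x y) = arith sub rT x y ∷ arith sub r x rT ∷ []

-- Only sums and products can leave the word range: differences and quotients never exceed their
-- first operand.
Needs : Op → ℕ → ℕ → Set
Needs add W v = v < W
Needs sub W v = ⊤
Needs mul W v = v < W
Needs div W v = ⊤

needs : ∀ o {W v} → v < W → Needs o W v
needs add v<W = v<W
needs sub v<W = tt
needs mul v<W = v<W
needs div v<W = tt

-- The value written by each instruction is named: substituting expressions
-- instead would make the stores grow exponentially.
wp : ℕ → List Atom → Assertion → Assertion
wp W []                   Φ R H = Φ R H
wp W (set r c ∷ as)       Φ R H = c < W × wp W as Φ (R [ r ≔ c ]) H
wp W (bin o r x y ∷ as)   Φ R H =
  ∃[ v ] ⟦ o ⟧ (R x) (R y) ≡ v × Needs o W v × wp W as Φ (R [ r ≔ v ]) H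
wp W (get r x ∷ as)       Φ R H = ∃[ v ] H (R x) ≡ v × wp W as Φ (R [ r ≔ v ]) H
wp W (put x y ∷ as)       Φ R H =
  ∃₂ λ p v → R x ≡ p × R y ≡ v × wp W as Φ R (H [ p ≔ v ])
wp W (flip ρ r t i ∷ as)  Φ R H =
  ∃[ v ] mirror ρ ((R [ rT ≔ 0 ]) t) ((R [ rT ≔ 0 ]) i) ≡ v × wp W as Φ ((R [ rT ≔ 0 ]) [ r ≔ v ]) H
wp W (better o r x y ∷ as) Φ R H = ∀ u →
  (R [ rT ≔ u ]) x ≡ R x × ∃[ v ] best o (R x) (R y) ≡ v × wp W as Φ ((R [ rT ≔ u ]) [ r ≔ v ]) H

block : List Atom → Code
block as _ = concatMap lower as

cost : List Atom → ℕ
cost as = length (concatMap lower as)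

fits-reg : ∀ {W R H} r {v} → v < W → Fits W ⟨ 0 , R , H ⟩ → Fits W ⟨ 0 , R [ r ≔ v ] , H ⟩
fits-reg {W} {R} r v<W (fR , fH) = ≔-elim (λ _ v → v < W) R r v<W (λ b _ → fR b) , fH

fits-mem : ∀ {W R H} a {v} → v < W → Fits W ⟨ 0 , R , H ⟩ → Fits W ⟨ 0 , R , H [ a ≔ v ] ⟩
fits-mem {W} {H = H} a v<W (fR , fH) = fR , ≔-elim (λ _ v → v < W) H a v<W (λ b _ → fH b)

op-< : ∀ o {W x y} → x < W → Needs o W (⟦ o ⟧ x y) → ⟦ o ⟧ x y < W
op-< add x<W ok = ok
op-< sub {x = x} {y} x<W ok = ≤-<-trans (m∸n≤m x y) x<W
op-< mul x<W ok = ok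
op-< div {y = zero} x<W ok = ≤-<-trans z≤n x<W
op-< div {x = x} {y = suc y} x<W ok = ≤-<-trans (m/n≤m x (suc y)) x<W

module _ {W : ℕ} where

  single : ∀ {ι R H R₁ H₁} {Φ : Assertion} →
    (∀ l → exec ι ⟨ l , R , H ⟩ ≡ ⟨ suc l , R₁ , H₁ ⟩) →
    (Fits W ⟨ 0 , R , H ⟩ → Fits W ⟨ 0 , R₁ , H₁ ⟩) →
    Φ R₁ H₁ → Ends W (λ _ → ι ∷ []) R H 1 Φ
  single {R₁ = R₁} {H₁} ex fits φ .run fit = 1 , R₁ , H₁ , ≤-refl ,
    (λ Q l pl → step fit (placed-head pl)
      (subst (λ s → Path Q W s 0 ⟨ l + 1 , R₁ , H₁ ⟩)
        (sym (trans (ex l) (cong (λ p → ⟨ p , R₁ , H₁ ⟩) (+-comm 1 l)))) [])) ,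
    fits fit , φ

  with-fits : ∀ {c R H b Φ} → (Fits W ⟨ 0 , R , H ⟩ → Ends W c R H b Φ) → Ends W c R H b Φ
  with-fits f .run fit = run (f fit) fit

  straight : ∀ as {Φ R H} → wp W as Φ R H → Ends W (block as) R H (cost as) Φ
  straight [] {R = R} {H} φ .run fit =
    0 , R , H , z≤n , (λ Q l pl → path-end (sym (+-identityʳ l)) []) , fit , φ
  straight (set r c ∷ as) (ok , w) =
    seq {d = block as} (single (λ l → refl) (fits-reg r ok) (straight as w))
  straight (bin o r x y ∷ as) (_ , refl , ok , w) = seq {d = block as} (single (λ l → refl)
    (λ fit → fits-reg r (op-< o (proj₁ fit x) ok) fit) (straight as w))
  straight (get r x ∷ as) {R = R} (_ , refl , w) = seq {d = block as} (single (λ l → refl)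
    (λ fit → fits-reg r (proj₂ fit (R x)) fit) (straight as w))
  straight (put x y ∷ as) {R = R} (_ , _ , refl , refl , w) = seq {d = block as} (single (λ l → refl)
    (λ fit → fits-mem (R x) (proj₁ fit y) fit) (straight as w))
  straight (flip false r t i ∷ as) (_ , refl , w) = seq {d = λ _ → _ ∷ concatMap lower as}
    (single (λ l → refl) (λ fit → fits-reg rT (≤-<-trans z≤n (proj₁ fit 0)) fit)
    (seq {d = block as} (single (λ l → refl) (λ fit → fits-reg r (proj₁ fit i) fit) (straight as w))))
  straight (flip true r t i ∷ as) {R = R} (_ , refl , w) = seq {d = λ _ → _ ∷ concatMap lower as}
    (single (λ l → refl) (λ fit → fits-reg rT (≤-<-trans z≤n (proj₁ fit 0)) fit)
    (seq {d = block as} (single (λ l → refl)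
      (λ fit → fits-reg r (op-< sub {y = (R [ rT ≔ 0 ]) i} (proj₁ fit t) tt) fit) (straight as w))))
  straight (better o r x y ∷ as) {Φ} {R} {H} pre with pre (gap o (R x) (R y))
  ... | eq , _ , refl , w = with-fits (go o eq w)
    where
    go : ∀ o → let R₁ = R [ rT ≔ gap o (R x) (R y) ] in
      R₁ x ≡ R x → wp W as Φ (R₁ [ r ≔ best o (R x) (R y) ]) H → Fits W ⟨ 0 , R , H ⟩ →
      Ends W (block (better o r x y ∷ as)) R H (cost (better o r x y ∷ as)) Φ
    go max-plus eq w fit = seq {d = λ _ → _ ∷ concatMap lower as}
      (single (λ l → refl) (fits-reg rT (op-< sub {y = R x} (proj₁ fit y) tt))
      (seq {d = block as} (single
        (λ l → cong (λ v → ⟨ suc l , (R [ rT ≔ R y ∸ R x ]) [ r ≔ v + (R y ∸ R x) ] , H ⟩) eq)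
        (fits-reg r (best-elim max-plus (_< W) (proj₁ fit x) (proj₁ fit y))) (straight as w))))
    go min-plus eq w fit = seq {d = λ _ → _ ∷ concatMap lower as}
      (single (λ l → refl) (fits-reg rT (op-< sub {y = R y} (proj₁ fit x) tt))
      (seq {d = block as} (single
        (λ l → cong (λ v → ⟨ suc l , (R [ rT ≔ R x ∸ R y ]) [ r ≔ v ∸ (R x ∸ R y) ] , H ⟩) eq)
        (fits-reg r (best-elim min-plus (_< W) (proj₁ fit x) (proj₁ fit y))) (straight as w))))

-- Calling a program as a subroutine

-- The simulated memory starts at the address in rBase.  A cell holds its value
-- plus the current epoch rE; once the epoch has grown by more than any value,
-- every cell reads as 0 again by truncated subtraction, so that the memory
-- need not be cleared between calls.
plain : Instr → List Atom
plain (const r c)     = set (30 + r) c ∷ set rT 0 ∷ set rT 0 ∷ []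
plain (arith o r x y) = bin o (30 + r) (30 + x) (30 + y) ∷ set rT 0 ∷ set rT 0 ∷ []
plain (load r x)      = bin add rT rBase (30 + x) ∷ get rT rT ∷ bin sub (30 + r) rT rE ∷ []
plain (store x y)     = bin add rT rBase (30 + x) ∷ bin add rU (30 + y) rE ∷ put rT rU ∷ []
plain (jump l)        = []
plain (jzero x l)     = []

-- Every instruction is padded to exactly three, so jump targets are translated by arithmetic alone.
-- The minimum sends every target outside the program, which means halting, to the end of the
-- translated text.
position : Program → ℕ → ℕ → ℕ
position P l p = l + (p ⊓ length P) * 3

translate : Program → ℕ → Instr → List Instr
translate P l (jump l′)    = jump (position P l l′) ∷ const rT 0 ∷ const rT 0 ∷ []
translate P l (jzero x l′) = jzero (30 + x) (position P l l′) ∷ const rT 0 ∷ const rT 0 ∷ []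
translate P l ι            = concatMap lower (plain ι)

simulate : Program → Code
simulate P l = concatMap (translate P l) P

length-translate : ∀ P l ι → length (translate P l ι) ≡ 3
length-translate P l (const r c)     = refl
length-translate P l (arith o r x y) = refl
length-translate P l (load r x)      = refl
length-translate P l (store x y)     = refl
length-translate P l (jump _)        = refl
length-translate P l (jzero x _)     = refl

length-concatMap : ∀ (f : Instr → List Instr) → (∀ ι → length (f ι) ≡ 3) →
  ∀ P → length (concatMap f P) ≡ length P * 3
length-concatMap f eq []      = refl
length-concatMap f eq (ι ∷ P) =
  trans (length-++ (f ι)) (cong₂ _+_ (eq ι) (length-concatMap f eq P))

placed-concatMap : ∀ (f : Instr → List Instr) → (∀ ι → length (f ι) ≡ 3) →
  ∀ P {Q l p ι} → Placed Q l (concatMap f P) → fetch P p ≡ just ι → Placed Q (l + p * 3) (f ι)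
placed-concatMap f eq (ι ∷ P) {Q} {l} {zero} pl refl =
  subst (λ a → Placed Q a (f ι)) (sym (+-identityʳ l)) (placed-++ˡ (f ι) pl)
placed-concatMap f eq (ι ∷ P) {Q} {l} {suc p} {κ} pl ft =
  subst (λ a → Placed Q a (f κ))
    (trans (cong (λ a → l + a + p * 3) (eq ι)) (+-assoc l 3 (p * 3)))
    (placed-concatMap f eq P (placed-++ʳ (f ι) pl) ft)

width : Instr → ℕ
width (const r c)     = suc r
width (arith o r x y) = suc (r + x + y)
width (load r x)      = suc (r + x)
width (store x y)     = suc (x + y)
width (jump l)        = 0
width (jzero x l)     = suc x

-- A crude bound on the registers in use, with sums in place of maxima. The 2 covers the registers 0
-- and 1, which receive the arguments.
registers : Program → ℕ
registers P = 2 + sum (map width P)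

width-≤ : ∀ P {p ι} → fetch P p ≡ just ι → width ι ≤ sum (map width P)
width-≤ (ι ∷ P) {zero}  refl = m≤m+n _ _
width-≤ (ι ∷ P) {suc p} eq   = ≤-trans (width-≤ P eq) (m≤n+m _ (width ι))

run-fits : ∀ {P W s t s′} → Run P W s t s′ → Fits W s
run-fits (halt fit _)   = fit
run-fits (step fit _ _) = fit

<! : ∀ {m n} {_ : T (m <ᵇ n)} → m < n
<! {m} {n} {p} = <ᵇ⇒< m n p

≤! : ∀ {m n} {_ : T (m ≤ᵇ n)} → m ≤ n
≤! {m} {n} {p} = ≤ᵇ⇒≤ m n p

beyond : ∀ (f : Store) {a v r} → 28 ≤ a → r < 28 → (f [ a ≔ v ]) r ≡ f r
beyond f 28≤a r<28 = ≔-other f (λ eq → <⇒≱ r<28 (≤-trans 28≤a (≤-reflexive (sym eq))))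

module Simulation (P : Program) (W V E base : ℕ) (base+V≤W : base + V ≤ W) (E+V≤W : E + V ≤ W) where

  -- `own` and `low` are the frame: the registers and cells of the caller survive the simulation.
  -- `fresh` prepares the next call: once the epoch has moved on to `E + V`, every cell reads as 0.
  record Simulates (R₀ H₀ : Store) (s : State) (R H : Store) : Set where
    field
      own   : ∀ {r} → r < 28 → R r ≡ R₀ r
      low   : ∀ {a} → a < base → H a ≡ H₀ a
      regs  : ∀ {r} → r < registers P → R (30 + r) ≡ reg s r
      cells : ∀ a → H (base + a) ∸ E ≡ mem s a
      fresh : ∀ a → H (base + a) < E + V

  open Simulates

  sim-≔ : ∀ {R S : Store} {r v v′} → v ≡ v′ →
    (∀ {x} → x < registers P → R (30 + x) ≡ S x) →
    ∀ {x} → x < registers P → (R [ 30 + r ≔ v ]) (30 + x) ≡ (S [ r ≔ v′ ]) x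
  sim-≔ {R} {S} {r} v≡ eq {x} = ≔-elim (λ y w → y < registers P → (R [ 30 + r ≔ _ ]) (30 + y) ≡ w) S r
    (λ _ → trans (≔-same R (30 + r)) v≡)
    (λ y y≢r y< → trans (≔-other R (λ e → y≢r (+-cancelˡ-≡ 30 _ _ e))) (eq y<)) x

  module _ {R₀ H₀ : Store} (E≡ : R₀ rE ≡ E) (base≡ : R₀ rBase ≡ base) where

    Reaches : State → ℕ → State → Store → Store → Set
    Reaches s t s′ R H = ∃[ t′ ] ∃₂ λ R′ H′ → t′ ≤ t * 3 ×
      (∀ Q l → Placed Q l (simulate P l) →
        Path Q W ⟨ position P l (pc s) , R , H ⟩ t′ ⟨ l + length P * 3 , R′ , H′ ⟩) ×
      Fits W ⟨ 0 , R′ , H′ ⟩ × Simulates R₀ H₀ s′ R′ H′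

    position-< : ∀ l {p ι} → fetch P p ≡ just ι → position P l p ≡ l + p * 3
    position-< l ft = cong (λ p → l + p * 3) (m≤n⇒m⊓n≡m (<⇒≤ (fetch-< P ft)))

    placed-at : ∀ {Q l p ι} → fetch P p ≡ just ι → Placed Q l (simulate P l) →
      Placed Q (position P l p) (translate P l ι)
    placed-at {Q} {l} {p} {ι} ft pl = subst (λ a → Placed Q a (translate P l ι)) (sym (position-< l ft))
      (placed-concatMap (translate P l) (length-translate P l) P pl ft)

    position-suc : ∀ l {p ι} → fetch P p ≡ just ι → position P l p + 3 ≡ position P l (suc p)
    position-suc l {p} ft rewrite m≤n⇒m⊓n≡m (<⇒≤ (fetch-< P ft)) | m≤n⇒m⊓n≡m (fetch-< P ft) =
      trans (+-assoc l (p * 3) 3) (cong (l +_) (+-comm (p * 3) 3))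

    sequential : ∀ {ι s t s′ R H} as → length (concatMap lower as) ≡ 3 →
      (∀ l → translate P l ι ≡ concatMap lower as) →
      fetch P (pc s) ≡ just ι → pc (exec ι s) ≡ suc (pc s) →
      Fits W ⟨ 0 , R , H ⟩ → wp W as (Simulates R₀ H₀ (exec ι s)) R H →
      (∀ {R′ H′} → Fits W ⟨ 0 , R′ , H′ ⟩ → Simulates R₀ H₀ (exec ι s) R′ H′ →
        Reaches (exec ι s) t s′ R′ H′) →
      Reaches s (suc t) s′ R H
    sequential {s = s} as len tr ft next fit w ih with run (straight as w) fit
    ... | t₁ , R₁ , H₁ , t₁≤ , path₁ , fit₁ , sim₁ with ih fit₁ sim₁
    ... | t₂ , R₂ , H₂ , t₂≤ , path₂ , fit₂ , sim₂ =
      t₁ + t₂ , R₂ , H₂ , +-mono-≤ (≤-trans t₁≤ (≤-reflexive len)) t₂≤ ,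
      (λ Q l pl → path-++
        (path-end (trans (cong (position P l (pc s) +_) len)
            (trans (position-suc l ft) (cong (position P l) (sym next))))
          (path₁ Q _ (subst (Placed Q _) (tr l) (placed-at ft pl))))
        (path₂ Q l pl)) ,
      fit₂ , sim₂

    -- Induction on the run of the subroutine. Each simulated step costs at most three steps; a
    -- taken jump costs one, as it leaves through the first instruction of its triple.
    simulate-run : ∀ {U s t s′} → U ≤ V → Run P U s t s′ →
      ∀ {R H} → Fits W ⟨ 0 , R , H ⟩ → Simulates R₀ H₀ s R H → Reaches s t s′ R H
    simulate-run {s = s} U≤V (halt _ end) {R} {H} fit sim = 0 , R , H , z≤n ,
      (λ Q l pl → path-end (cong (λ p → l + p * 3) (m≥n⇒m⊓n≡n (fetch-≥ P end))) []) , fit , sim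
    simulate-run {U} {s} {suc t} {s′} U≤V (step {ι = ι} fits ft run′) {R} {H} fit sim = go ι refl
      where
      V≤W : V ≤ W
      V≤W = ≤-trans (m≤n+m V base) base+V≤W

      0<W : 0 < W
      0<W = ≤-<-trans z≤n (proj₁ fit 0)

      reg< : ∀ x → reg s x < V
      reg< x = <-≤-trans (proj₁ fits x) U≤V

      -- The range of a computed value is read off the next state of the subroutine, all of whose
      -- words are below `U`; no overflow analysis of `P` is required.
      result< : ∀ {r v} → (∀ x → reg (exec ι s) x ≡ (reg s [ r ≔ v ]) x) → v < V
      result< {r} {v} eq = <-≤-trans
        (subst (_< U) (trans (eq r) (≔-same (reg s) r)) (proj₁ (run-fits run′) r)) U≤V

      in-range : ∀ {x} → suc x ≤ width ι → x < registers P
      in-range x<w = ≤-trans x<w (≤-trans (width-≤ P ft) (m≤n+m _ 2))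

      E≡′ : R rE ≡ E
      E≡′ = trans (own sim <!) E≡

      address : ∀ {x} → suc x ≤ width ι → R rBase + R (30 + x) ≡ base + reg s x
      address x<w = cong₂ _+_ (trans (own sim <!) base≡) (regs sim (in-range x<w))

      address< : ∀ x → base + reg s x < W
      address< x = <-≤-trans (+-monoʳ-< base (reg< x)) base+V≤W

      continue : ∀ {R′ H′} → Fits W ⟨ 0 , R′ , H′ ⟩ → Simulates R₀ H₀ (exec ι s) R′ H′ →
        Reaches (exec ι s) t s′ R′ H′
      continue = simulate-run U≤V run′

      jumping : ∀ (κ : ℕ → Instr) → (∀ l → ∃ λ is → translate P l ι ≡ κ l ∷ is) →
        (∀ l → exec (κ l) ⟨ position P l (pc s) , R , H ⟩ ≡ ⟨ position P l (pc (exec ι s)) , R , H ⟩) →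
        Simulates R₀ H₀ (exec ι s) R H → Reaches s (suc t) s′ R H
      jumping κ tr ex sim′ with continue fit sim′
      ... | t₂ , R₂ , H₂ , t₂≤ , path₂ , fit₂ , sim₂ =
        suc t₂ , R₂ , H₂ , s≤s (≤-trans t₂≤ (m≤n+m _ 2)) ,
        (λ Q l pl → step fit
          (placed-head (subst (Placed Q _) (proj₂ (tr l)) (placed-at ft pl)))
          (subst (λ s → Path Q W s t₂ _) (sym (ex l)) (path₂ Q l pl))) ,
        fit₂ , sim₂

      kept₂ : ∀ {a b v u r} → 28 ≤ a → 28 ≤ b → r < 28 → ((R [ a ≔ v ]) [ b ≔ u ]) r ≡ R₀ r
      kept₂ {a} {v = v} 28≤a 28≤b r< =
        trans (beyond (R [ a ≔ v ]) 28≤b r<) (trans (beyond R 28≤a r<) (own sim r<))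

      kept₃ : ∀ {a b c v u w r} → 28 ≤ a → 28 ≤ b → 28 ≤ c → r < 28 →
        (((R [ a ≔ v ]) [ b ≔ u ]) [ c ≔ w ]) r ≡ R₀ r
      kept₃ {a} {b} {v = v} {u} 28≤a 28≤b 28≤c r< =
        trans (beyond ((R [ a ≔ v ]) [ b ≔ u ]) 28≤c r<) (kept₂ 28≤a 28≤b r<)

      go : ∀ κ → κ ≡ ι → Reaches s (suc t) s′ R H
      go (const r c) refl = sequential {ι} {s} {t} (plain ι) refl (λ l → refl) ft refl fit
        (<-≤-trans (result< (λ _ → refl)) V≤W , 0<W , 0<W , record
          { own   = λ r< → kept₃ {a = 30 + r} {b = 28} {c = 28} ≤! ≤! ≤! r<
          ; low   = low sim
          ; regs  = sim-≔ {R = R} refl (regs sim)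
          ; cells = cells sim
          ; fresh = fresh sim })
        continue
      go (arith o r x y) refl = sequential {ι} {s} {t} (plain ι) refl (λ l → refl) ft refl fit
        (_ , value , needs o (<-≤-trans (result< (λ _ → refl)) V≤W) , 0<W , 0<W , record
          { own   = λ r< → kept₃ {a = 30 + r} {b = 28} {c = 28} ≤! ≤! ≤! r<
          ; low   = low sim
          ; regs  = sim-≔ {R = R} refl (regs sim)
          ; cells = cells sim
          ; fresh = fresh sim })
        continue
        where
        value : ⟦ o ⟧ (R (30 + x)) (R (30 + y)) ≡ ⟦ o ⟧ (reg s x) (reg s y)
        value = cong₂ ⟦ o ⟧
          (regs sim (in-range (s≤s (≤-trans (m≤n+m x r) (m≤m+n (r + x) y)))))
          (regs sim (in-range (s≤s (m≤n+m y (r + x)))))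
      go (load r x) refl = sequential {ι} {s} {t} (plain ι) refl (λ l → refl) ft refl fit
        (_ , address x< , address< x , _ , refl , _ , cong₂ _∸_ refl E≡′ , tt , record
          { own   = λ r< → kept₃ {a = 28} {b = 28} {c = 30 + r} ≤! ≤! ≤! r<
          ; low   = low sim
          ; regs  = sim-≔ {R = R} (cells sim (reg s x)) (regs sim)
          ; cells = cells sim
          ; fresh = fresh sim })
        continue
        where
        x< : suc x ≤ width ι
        x< = s≤s (m≤n+m x r)
      go (store x y) refl = sequential {ι} {s} {t} (plain ι) refl (λ l → refl) ft refl fit
        (_ , address x< , address< x , _ , value , ≤-trans cell< E+V≤W , _ , _ , refl , refl , record
          { own   = λ r< → kept₂ {a = 28} {b = 29} ≤! ≤! r<
          ; low   = λ a<base → trans (≔-other H (λ eq → <⇒≱ a<base (≤-trans (m≤m+n base (reg s x))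
              (≤-reflexive (sym eq))))) (low sim a<base)
          ; regs  = regs sim
          ; cells = λ a → cells′ a
          ; fresh = λ a → fresh′ a })
        continue
        where
        x< : suc x ≤ width ι
        x< = s≤s (m≤m+n x y)
        value : R (30 + y) + R rE ≡ reg s y + E
        value = cong₂ _+_ (regs sim (in-range (s≤s (m≤n+m y x)))) E≡′
        cell< : reg s y + E < E + V
        cell< = subst (_< E + V) (+-comm E (reg s y)) (+-monoʳ-< E (reg< y))
        cells′ : ∀ a → (H [ base + reg s x ≔ reg s y + E ]) (base + a) ∸ E
          ≡ (mem s [ reg s x ≔ reg s y ]) a
        cells′ = ≔-elim
          (λ a v → (H [ base + reg s x ≔ reg s y + E ]) (base + a) ∸ E ≡ v) (mem s) (reg s x)
          (trans (cong (_∸ E) (≔-same H (base + reg s x))) (m+n∸n≡m (reg s y) E))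
          (λ b b≢x → trans (cong (_∸ E) (≔-other H (λ eq → b≢x (+-cancelˡ-≡ base _ _ eq)))) (cells sim b))
        fresh′ : ∀ a → (H [ base + reg s x ≔ reg s y + E ]) (base + a) < E + V
        fresh′ a with base + a ≟ base + reg s x
        ... | yes _ = cell<
        ... | no _  = fresh sim a
      go (jump l′) refl = jumping (λ l → jump (position P l l′)) (λ l → _ , refl) (λ l → refl) record
        { own = own sim ; low = low sim ; regs = regs sim ; cells = cells sim ; fresh = fresh sim }
      go (jzero x l′) refl with reg s x ≟ 0
      ... | yes eq = jumping (λ l → jzero (30 + x) (position P l l′)) (λ l → _ , refl)
        (λ l → trans (exec-jzero-zero (30 + x) _ _ R H (trans (regs sim (in-range ≤-refl)) eq))
          (cong (λ s → ⟨ position P l (pc s) , R , H ⟩) (sym next)))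
        (subst (λ s → Simulates R₀ H₀ s R H) (sym next) record
          { own = own sim ; low = low sim ; regs = regs sim ; cells = cells sim ; fresh = fresh sim })
        where next = exec-jzero-zero x l′ (pc s) (reg s) (mem s) eq
      ... | no neq with run (straight (set rT 0 ∷ set rT 0 ∷ []) (0<W , 0<W , record
          { own = kept₂ ≤! ≤! ; low = low sim ; regs = regs sim ; cells = cells sim ; fresh = fresh sim })) fit
      ... | t₁ , R₁ , H₁ , t₁≤ , path₁ , fit₁ , sim₁
        with continue fit₁ (subst (λ s → Simulates R₀ H₀ s R₁ H₁)
          (sym (exec-jzero-suc x l′ (pc s) (reg s) (mem s) neq)) sim₁)
      ... | t₂ , R₂ , H₂ , t₂≤ , path₂ , fit₂ , sim₂ =
        suc (t₁ + t₂) , R₂ , H₂ , s≤s (+-mono-≤ t₁≤ t₂≤) ,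
        (λ Q l pl → step fit (placed-head (placed-at ft pl))
          (subst (λ s → Path Q W s (t₁ + t₂) ⟨ l + length P * 3 , R₂ , H₂ ⟩)
            (sym (exec-jzero-suc (30 + x) _ _ R H (λ eq → neq (trans (sym (regs sim (in-range ≤-refl))) eq))))
            (path-++ (path-end (trans (sym (+-suc _ 2))
                (trans (position-suc l ft) (cong (position P l) (cong pc (sym next)))))
                (path₁ Q _ (placed-tail (placed-at ft pl))))
              (path₂ Q l pl)))) ,
        fit₂ , sim₂
        where next = exec-jzero-suc x l′ (pc s) (reg s) (mem s) neq

clear : ℕ → List Atom
clear zero    = []
clear (suc k) = set (30 + k) 0 ∷ clear k

enter : Program → List Atom
enter P = clear (registers P) ++ flip false 30 rSize rSize ∷ flip false 31 rM rM ∷ []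

call : Program → Code
call P = block (enter P) ⨾ simulate P

arguments : ℕ → ℕ → Store
arguments m M 0 = m
arguments m M 1 = M
arguments m M _ = 0

wp-++ : ∀ {W} as {bs Φ R H} → wp W as (wp W bs Φ) R H → wp W (as ++ bs) Φ R H
wp-++ []                    w        = w
wp-++ (set r c ∷ as)        (ok , w)                = ok , wp-++ as w
wp-++ (bin o r x y ∷ as)    (v , eq , ok , w)       = v , eq , ok , wp-++ as w
wp-++ (get r x ∷ as)        (v , eq , w)            = v , eq , wp-++ as w
wp-++ (put x y ∷ as)        (p , v , eq , eq′ , w)  = p , v , eq , eq′ , wp-++ as w
wp-++ (flip ρ r t i ∷ as)   (v , eq , w)            = v , eq , wp-++ as w
wp-++ (better o r x y ∷ as) w u with w u
... | ok , v , eq , w′ = ok , v , eq , wp-++ as w′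

wp-clear : ∀ {W} k {Φ R H} → 0 < W →
  (∀ R′ → (∀ {r} → r < 30 → R′ r ≡ R r) → (∀ {r} → r < k → R′ (30 + r) ≡ 0) → Φ R′ H) →
  wp W (clear k) Φ R H
wp-clear k {R = R} 0<W φ = go k 0<W λ R′ own zeros _ → φ R′ own zeros
  where
  -- Strengthened by the fact that `clear k` preserves the registers from `30 + k` on: it keeps the
  -- zero that the preceding instruction has just written to register `30 + k`.
  go : ∀ {W} k {Φ R H} → 0 < W →
    (∀ R′ → (∀ {r} → r < 30 → R′ r ≡ R r) → (∀ {r} → r < k → R′ (30 + r) ≡ 0) →
      (∀ {r} → k ≤ r → R′ (30 + r) ≡ R (30 + r)) → Φ R′ H) →
    wp W (clear k) Φ R H
  go zero    {R = R} 0<W φ = φ R (λ _ → refl) (λ ()) (λ _ → refl)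
  go (suc k) {R = R} 0<W φ = 0<W , go k 0<W λ R′ own zeros rest → φ R′
    (λ r<30 → trans (own r<30) (≔-other R (λ eq → <⇒≱ r<30 (≤-trans (m≤m+n 30 k) (≤-reflexive (sym eq))))))
    (λ {r} r<k+1 → below R′ zeros rest r<k+1)
    (λ {r} k<r → trans (rest (<⇒≤ k<r)) (≔-other R (λ eq → <⇒≢ k<r (sym (+-cancelˡ-≡ 30 _ _ eq)))))
    where
    below : ∀ R′ → (∀ {r} → r < k → R′ (30 + r) ≡ 0) →
      (∀ {r} → k ≤ r → R′ (30 + r) ≡ (R [ 30 + k ≔ 0 ]) (30 + r)) →
      ∀ {r} → r < suc k → R′ (30 + r) ≡ 0
    below R′ zeros rest {r} r<k+1 with r ≟ k
    ... | yes refl = trans (rest ≤-refl) (≔-same R (30 + k))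
    ... | no r≢k   = zeros (≤∧≢⇒< (≤-pred r<k+1) r≢k)

cost-enter : ∀ P → cost (enter P) ≡ registers P + 4
cost-enter P = go (registers P)
  where
  go : ∀ k → cost (clear k ++ flip false 30 rSize rSize ∷ flip false 31 rM rM ∷ []) ≡ k + 4
  go zero    = refl
  go (suc k) = cong suc (go k)

module _ {P : Program} {W V E base : ℕ} (base+V≤W : base + V ≤ W) (E+V≤W : E + V ≤ W) where

  open Simulation P W V E base base+V≤W E+V≤W
  open Simulates

  simulate-ends : ∀ {R₀ H₀ U s t s′ R H} → R₀ rE ≡ E → R₀ rBase ≡ base → U ≤ V →
    Run P U s t s′ → pc s ≡ 0 → Simulates R₀ H₀ s R H →
    Ends W (simulate P) R H (t * 3) (Simulates R₀ H₀ s′)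
  simulate-ends {R = R} {H} E≡ base≡ U≤V run′ refl sim .run fit
    with simulate-run E≡ base≡ U≤V run′ fit sim
  ... | t′ , R′ , H′ , t′≤ , path , fit′ , sim′ = t′ , R′ , H′ , t′≤ ,
    (λ Q l pl → subst (λ a → Path Q W ⟨ a , R , H ⟩ t′ ⟨ l + length (simulate P l) , R′ , H′ ⟩) (+-identityʳ l)
      (path-end (cong (l +_) (sym (length-concatMap (translate P l) (length-translate P l) P))) (path Q l pl))) ,
    fit′ , sim′

  call-ends : ∀ {U t s′ m M R H} → R rE ≡ E → R rBase ≡ base → R rSize ≡ m → R rM ≡ M → U ≤ V →
    (∀ a → H (base + a) < E + V) →
    Run P U ⟨ 0 , arguments m M , (λ a → H (base + a) ∸ E) ⟩ t s′ →
    Ends W (call P) R H (registers P + 4 + t * 3) (Simulates R H s′)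
  call-ends {t = t} {s′} {m} {M} {R} {H} E≡ base≡ m≡ M≡ U≤V fresh′ run′ =
    with-fits λ fit → subst (λ b → Ends W (call P) R H (b + t * 3) (Simulates R H s′)) (cost-enter P)
      (seq {c = block (enter P)} {d = simulate P} (straight (enter P)
        (wp-++ (clear (registers P)) (wp-clear (registers P) (≤-<-trans z≤n (proj₁ fit 0)) entered))))
    where
    entered : ∀ R′ → (∀ {r} → r < 30 → R′ r ≡ R r) → (∀ {r} → r < registers P → R′ (30 + r) ≡ 0) →
      wp W (flip false 30 rSize rSize ∷ flip false 31 rM rM ∷ [])
        (λ R″ H″ → Ends W (simulate P) R″ H″ (t * 3) (Simulates R H s′)) R′ H
    entered R′ own′ zeros = m , trans (own′ <!) m≡ , M , trans (own′ <!) M≡ ,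
      simulate-ends E≡ base≡ U≤V run′ refl record
      { own   = λ r<28 →
          trans (beyond ((R₁ [ 30 ≔ m ]) [ 28 ≔ 0 ]) ≤! r<28)
          (trans (beyond (R₁ [ 30 ≔ m ]) ≤! r<28) (trans (beyond R₁ ≤! r<28)
          (trans (beyond R′ ≤! r<28) (own′ (<-trans r<28 <!)))))
      ; low   = λ _ → refl
      ; regs  = λ {r} → loaded r
      ; cells = λ _ → refl
      ; fresh = fresh′ }
      where
      R₁ = R′ [ 28 ≔ 0 ]
      loaded : ∀ r → r < registers P →
        (((R₁ [ 30 ≔ m ]) [ 28 ≔ 0 ]) [ 31 ≔ M ]) (30 + r) ≡ arguments m M r
      loaded 0             _  = refl
      loaded 1             _  = refl
      loaded (suc (suc r)) r< = zeros r<

-- Lower bound for T₂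

-- `1 ⊓ v` is the indicator of `v ≢ 0`.
nonzeros : Store → ℕ → ℕ → ℕ
nonzeros H a zero    = 0
nonzeros H a (suc k) = 1 ⊓ H (a + k) + nonzeros H a k

nonzeros-all : ∀ H a k → (∀ i → i < k → H (a + i) ≢ 0) → nonzeros H a k ≡ k
nonzeros-all H a zero    nz = refl
nonzeros-all H a (suc k) nz =
  cong₂ _+_ (m≤n⇒m⊓n≡m (n≢0⇒n>0 (nz k ≤-refl))) (nonzeros-all H a k (λ i i<k → nz i (m<n⇒m<1+n i<k)))

nonzeros-none : ∀ H a k → (∀ i → H (a + i) ≡ 0) → nonzeros H a k ≡ 0
nonzeros-none H a zero    z = refl
nonzeros-none H a (suc k) z rewrite z k = nonzeros-none H a k z

nonzeros-outside : ∀ H a k {p v} → a + k ≤ p → nonzeros (H [ p ≔ v ]) a k ≡ nonzeros H a k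
nonzeros-outside H a zero    a+k≤p = refl
nonzeros-outside H a (suc k) {p} a+k≤p = cong₂ (λ x y → 1 ⊓ x + y)
  (≔-other H (<⇒≢ a+k<p)) (nonzeros-outside H a k (<⇒≤ a+k<p))
  where
  a+k<p : a + k < p
  a+k<p = subst (_≤ p) (+-suc a k) a+k≤p

nonzeros-≔ : ∀ H a k {p v} → nonzeros (H [ p ≔ v ]) a k ≤ suc (nonzeros H a k)
nonzeros-≔ H a zero = z≤n
nonzeros-≔ H a (suc k) {p} {v} with a + k ≟ p
... | yes refl rewrite nonzeros-outside H a k {a + k} {v} ≤-refl =
  +-mono-≤ (m⊓n≤m 1 v) (m≤n+m _ (1 ⊓ H (a + k)))
... | no _ = ≤-trans (+-monoʳ-≤ (1 ⊓ H (a + k)) (nonzeros-≔ H a k)) (≤-reflexive (+-suc _ _))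

-- A step writes at most one cell and hence creates at most one nonzero entry.
run-nonzeros : ∀ {P W s t s′} a k → Run P W s t s′ → nonzeros (mem s′) a k ≤ t + nonzeros (mem s) a k
run-nonzeros a k (halt _ _) = ≤-refl
run-nonzeros {s = s} a k (step {ι = ι} {t} _ _ r) = ≤-trans (run-nonzeros a k r)
  (≤-trans (+-monoʳ-≤ t (exec-nonzeros ι)) (≤-reflexive (+-suc t _)))
  where
  exec-nonzeros : ∀ ι → nonzeros (mem (exec ι s)) a k ≤ suc (nonzeros (mem s) a k)
  exec-nonzeros (const r c)     = n≤1+n _
  exec-nonzeros (arith o r x y) = n≤1+n _
  exec-nonzeros (load r x)      = n≤1+n _
  exec-nonzeros (store x y)     = nonzeros-≔ (mem s) a k
  exec-nonzeros (jump l)        = n≤1+n _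
  exec-nonzeros (jzero x l) with reg s x
  ... | zero  = n≤1+n _
  ... | suc _ = n≤1+n _

-- On constant inputs M all 2m - 1 outputs are nonzero, and each needs a step.
time-≥ : ∀ {o d T P} → ComputesInTime o (λ A B → Monotone d A × Monotone d B) T P →
  ∀ m M → 1 ≤ m → 1 ≤ M → 2 * m ∸ 1 ≤ T m M
time-≥ {o} {d} {T₂} (w , spec) m M 1≤m 1≤M = bound
  where
  A : Fin m → ℕ
  A _ = M

  H₀ : Store
  H₀ a with a <? 2 * m
  ... | yes _ = M
  ... | no _  = 0

  H₀-input : ∀ {a} → a < 2 * m → H₀ a ≡ M
  H₀-input {a} a< with a <? 2 * m
  ... | yes _ = refl
  ... | no a≮ = contradiction a< a≮

  H₀-rest : ∀ {a} → 2 * m ≤ a → H₀ a ≡ 0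
  H₀-rest {a} ≤a with a <? 2 * m
  ... | yes a< = contradiction a< (≤⇒≯ ≤a)
  ... | no _   = refl

  constant : ∀ d → Monotone d A
  constant non-decreasing _ = ≤-refl
  constant non-increasing _ = ≤-refl

  bound : 2 * m ∸ 1 ≤ T₂ m M
  bound with spec M A A 1≤m (λ _ → ≤-refl) (λ _ → ≤-refl) (constant d , constant d)
    ⟨ 0 , arguments m M , H₀ ⟩ record
      { pc-start = refl ; reg-n = refl ; reg-M = refl
      ; reg-rest = λ where (suc (suc r)) _ → refl ; (suc zero) (s≤s ())
      ; mem-A    = λ i → H₀-input (<-≤-trans (toℕ<n i) (m≤m+n m _))
      ; mem-B    = λ j → H₀-input (subst (λ k → m + toℕ j < m + k) (sym (+-identityʳ m)) (+-monoʳ-< m (toℕ<n j)))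
      ; mem-rest = λ a → H₀-rest }
  ... | t , s′ , run′ , t≤ , conv = begin
    2 * m ∸ 1                                            ≡⟨ nonzeros-all (mem s′) (2 * m) (2 * m ∸ 1) nonzero ⟨
    nonzeros (mem s′) (2 * m) (2 * m ∸ 1)                ≤⟨ run-nonzeros (2 * m) (2 * m ∸ 1) run′ ⟩
    t + nonzeros H₀ (2 * m) (2 * m ∸ 1)                  ≡⟨ cong (t +_) no-outputs ⟩
    t + 0                                                ≡⟨ +-identityʳ t ⟩
    t                                                    ≤⟨ t≤ ⟩
    T₂ m M                                               ∎
    where
    open ≤-Reasoning
    no-outputs : nonzeros H₀ (2 * m) (2 * m ∸ 1) ≡ 0
    no-outputs = nonzeros-none H₀ (2 * m) (2 * m ∸ 1) (λ i → H₀-rest (m≤m+n _ i))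
    nonzero : ∀ i → i < 2 * m ∸ 1 → mem s′ (2 * m + i) ≢ 0
    nonzero i i< with proj₁ (conv (fromℕ< i<))
    ... | _ , _ , _ , eq rewrite toℕ-fromℕ< i< = λ z → <⇒≢ (≤-trans 1≤M (m≤m+n M M)) (sym (trans eq z))

-- Prefix optima and windows

-- Whether indices have to be reversed to make A increase towards the extremum.
reversal : Extremum → Direction → Bool
reversal max-plus non-decreasing = false
reversal max-plus non-increasing = true
reversal min-plus non-decreasing = true
reversal min-plus non-increasing = false

Improving : Extremum → ℕ → Store → Set
Improving o n f = ∀ {i j} → i ≤ j → j < n → Dominates o (f j) (f i)

mirror-< : ∀ ρ {n i} → i < n → mirror ρ (n ∸ 1) i < n
mirror-< ρ {suc n} (s≤s i≤n) = s≤s (mirror-≤ ρ i≤n)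

Ordered : Direction → ℕ → ℕ → Set
Ordered non-decreasing x y = x ≤ y
Ordered non-increasing x y = x ≥ y

monotone⇒ordered : ∀ d {n} {A : Vector ℕ n} {f : Store} → (∀ i → f (toℕ i) ≡ A i) → Monotone d A →
  ∀ {i j} → i ≤ j → j < n → Ordered d (f i) (f j)
monotone⇒ordered d {n} {A} {f} f≡A mono {i} {j} i≤j j<n = subst₂ (Ordered d) (A≡f i<n) (A≡f j<n)
  (go d mono (subst₂ _≤_ (sym (toℕ-fromℕ< i<n)) (sym (toℕ-fromℕ< j<n)) i≤j))
  where
  i<n : i < n
  i<n = ≤-<-trans i≤j j<n

  A≡f : ∀ {k} (k<n : k < n) → A (fromℕ< k<n) ≡ f k
  A≡f k<n = trans (sym (f≡A (fromℕ< k<n))) (cong f (toℕ-fromℕ< k<n))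

  go : ∀ d → Monotone d A → ∀ {x y} → toℕ x ≤ toℕ y → Ordered d (A x) (A y)
  go non-decreasing mono = mono
  go non-increasing mono = mono

ordered⇒monotone : ∀ d {n} {f : Store} →
  (∀ {i j} → i ≤ j → j < n → Ordered d (f i) (f j)) → Monotone d (λ (i : Fin n) → f (toℕ i))
ordered⇒monotone non-decreasing ord {x} {y} x≤y = ord x≤y (toℕ<n y)
ordered⇒monotone non-increasing ord {x} {y} x≤y = ord x≤y (toℕ<n y)

ordered⇒improving : ∀ o d {n} {f : Store} →
  (∀ {i j} → i ≤ j → j < n → Ordered d (f i) (f j)) →
  Improving o n (f ∘ mirror (reversal o d) (n ∸ 1))
ordered⇒improving max-plus non-decreasing     ord i≤j j<n = ord i≤j j<n
ordered⇒improving max-plus non-increasing {n} ord i≤j j<n =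
  ord (∸-monoʳ-≤ (n ∸ 1) i≤j) (mirror-< true (≤-<-trans i≤j j<n))
ordered⇒improving min-plus non-decreasing {n} ord i≤j j<n =
  ord (∸-monoʳ-≤ (n ∸ 1) i≤j) (mirror-< true (≤-<-trans i≤j j<n))
ordered⇒improving min-plus non-increasing     ord i≤j j<n = ord i≤j j<n

improving⇒ordered : ∀ o d {n} {f : Store} → Improving o n (f ∘ mirror (reversal o d) (n ∸ 1)) →
  ∀ {i j} → i ≤ j → j < n → Ordered d (f i) (f j)
improving⇒ordered max-plus non-decreasing imp i≤j j<n = imp i≤j j<n
improving⇒ordered max-plus non-increasing {suc n} {f} imp {i} {j} i≤j (s≤s j≤n) = subst₂ (λ x y → f x ≥ f y)
  (m∸[m∸n]≡n (≤-trans i≤j j≤n)) (m∸[m∸n]≡n j≤n) (imp (∸-monoʳ-≤ n i≤j) (s≤s (m∸n≤m n i)))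
improving⇒ordered min-plus non-decreasing {suc n} {f} imp {i} {j} i≤j (s≤s j≤n) = subst₂ (λ x y → f x ≤ f y)
  (m∸[m∸n]≡n (≤-trans i≤j j≤n)) (m∸[m∸n]≡n j≤n) (imp (∸-monoʳ-≤ n i≤j) (s≤s (m∸n≤m n i)))
improving⇒ordered min-plus non-increasing imp i≤j j<n = imp i≤j j<n

-- The minimum, in precisely the form that `better min-plus` computes.
clip : ℕ → ℕ → ℕ
clip x top = best min-plus x top

clip-≤ˡ : ∀ x top → clip x top ≤ x
clip-≤ˡ x top = best-domˡ min-plus x top

clip-≤ʳ : ∀ x top → clip x top ≤ top
clip-≤ʳ x top = best-domʳ min-plus x top

clip-≥ : ∀ {b x top} → b ≤ x → b ≤ top → b ≤ clip x top
clip-≥ {b} b≤x b≤top = best-elim min-plus (b ≤_) b≤x b≤top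

clip-id : ∀ {x top} → x ≤ top → clip x top ≡ x
clip-id {x} {top} x≤top = ≤-antisym (clip-≤ˡ x top) (clip-≥ ≤-refl x≤top)

module Prefix (o : Extremum) (f : Store) (top b : ℕ) where

  -- The value of the accumulator before round `i`. Entry `y` of a window is thus `prefix (suc y)`,
  -- the optimum of `f` over the indices from `b` to `b + y`; round 0 combines `f b` with itself
  -- when `b ≤ top`. A window running past the end repeats the entry at `top`, which adds no new
  -- candidate.
  prefix : ℕ → ℕ
  prefix zero    = f b
  prefix (suc i) = best o (prefix i) (f (clip (b + i) top))

  prefix-mono : ∀ {i j} → i ≤ j → Dominates o (prefix j) (prefix i)
  prefix-mono i≤j = go (≤⇒≤′ i≤j)
    where
    go : ∀ {i j} → i ≤′ j → Dominates o (prefix j) (prefix i)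
    go ≤′-refl      = dom-refl o
    go (≤′-step i≤j) = dom-trans o (best-domˡ o _ _) (go i≤j)

  prefix-dom : ∀ {y j} → b ≤ j → j ≤ b + y → j ≤ top → Dominates o (prefix (suc y)) (f j)
  prefix-dom {y} {j} b≤j j≤b+y j≤top = dom-trans o (prefix-mono (s≤s (m≤n+o⇒m∸n≤o j b j≤b+y)))
    (subst (λ k → Dominates o (prefix (suc (j ∸ b))) (f k))
      (trans (cong (λ k → clip k top) (m+[n∸m]≡n b≤j)) (clip-id j≤top)) (best-domʳ o _ _))

  prefix-attained : b ≤ top → ∀ y → ∃[ j ] b ≤ j × j ≤ b + y × j ≤ top × prefix (suc y) ≡ f j
  prefix-attained b≤top zero = b , ≤-refl , m≤m+n b 0 , b≤top ,
    best-elim o (_≡ f b) refl (cong f (trans (cong (λ k → clip k top) (+-identityʳ b)) (clip-id b≤top)))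
  prefix-attained b≤top (suc y) = best-elim o (λ v → ∃[ j ] b ≤ j × j ≤ b + suc y × j ≤ top × v ≡ f j)
    (let j , b≤j , j≤ , j≤top , eq = prefix-attained b≤top y in
      j , b≤j , ≤-trans j≤ (+-monoʳ-≤ b (n≤1+n y)) , j≤top , eq)
    (_ , clip-≥ (m≤m+n b (suc y)) b≤top , clip-≤ˡ (b + suc y) top , clip-≤ʳ (b + suc y) top , refl)

  prefix-≤ : ∀ {M} → b ≤ top → (∀ {j} → j ≤ top → f j ≤ M) → ∀ i → prefix i ≤ M
  prefix-≤ b≤top f≤M zero = f≤M b≤top
  prefix-≤ {M} b≤top f≤M (suc i) =
    best-elim o (_≤ M) (prefix-≤ b≤top f≤M i) (f≤M (clip-≤ʳ (b + i) top))

-- A window of length m starting at b, convolved with the last m entries of f: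
-- an entry of the prefix optimum stems from an earlier index of g, which is
-- compensated by a later, hence at least as good, index of f.
module Window (o : Extremum) {n : ℕ} (f g : Store) (f-improving : Improving o n f)
  {m b : ℕ} (m≤n : m ≤ n) (b<n : b < n) where

  open Prefix o g (n ∸ 1) b

  ≤pred⇒< : ∀ {j} → j ≤ n ∸ 1 → j < n
  ≤pred⇒< j≤ = subst (_ ≤_) (m+[n∸m]≡n (≤-trans (s≤s z≤n) b<n)) (s≤s j≤)

  -- Replacing `b + y` by the index `j` where the prefix optimum is attained raises the index of `f`
  -- by `b + y - j`. The assumption `x + y < m` keeps the raised index below `n`; this is why only
  -- the first `m` of the `2m - 1` entries of an answer are used.
  window-sound : ∀ {x y} → x + y < m → ∃₂ λ i j → i < n × j < n ×
    i + j ≡ (n ∸ m) + b + (x + y) × Dominates o (f i + g j) (f (n ∸ m + x) + prefix (suc y))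
  window-sound {x} {y} x+y<m with prefix-attained (<⇒≤pred b<n) y
  ... | j , b≤j , j≤b+y , j≤top , eq =
    n ∸ m + (x + y ∸ (j ∸ b)) , j , i<n , ≤pred⇒< j≤top , index ,
    dom-+ o (f-improving (+-monoʳ-≤ (n ∸ m) x≤) i<n) (subst (Dominates o (g j)) (sym eq) (dom-refl o))
    where
    z≤y : j ∸ b ≤ y
    z≤y = m≤n+o⇒m∸n≤o j b j≤b+y
    x≤ : x ≤ x + y ∸ (j ∸ b)
    x≤ = subst (x ≤_) (sym (+-∸-assoc x z≤y)) (m≤m+n x _)
    i<n : n ∸ m + (x + y ∸ (j ∸ b)) < n
    i<n = subst (n ∸ m + (x + y ∸ (j ∸ b)) <_) (m∸n+n≡m m≤n)
      (+-monoʳ-< (n ∸ m) (≤-<-trans (m∸n≤m (x + y) (j ∸ b)) x+y<m))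
    index : n ∸ m + (x + y ∸ (j ∸ b)) + j ≡ (n ∸ m) + b + (x + y)
    index = begin
      n ∸ m + (x + y ∸ (j ∸ b)) + j               ≡⟨ cong (n ∸ m + (x + y ∸ (j ∸ b)) +_) (m∸n+n≡m b≤j) ⟨
      n ∸ m + (x + y ∸ (j ∸ b)) + (j ∸ b + b)     ≡⟨ +-assoc (n ∸ m + (x + y ∸ (j ∸ b))) (j ∸ b) b ⟨
      n ∸ m + (x + y ∸ (j ∸ b)) + (j ∸ b) + b     ≡⟨ cong (_+ b) (+-assoc (n ∸ m) (x + y ∸ (j ∸ b)) (j ∸ b)) ⟩
      n ∸ m + (x + y ∸ (j ∸ b) + (j ∸ b)) + b     ≡⟨ cong (λ k → n ∸ m + k + b) (m∸n+n≡m (≤-trans z≤y (m≤n+m y x))) ⟩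
      n ∸ m + (x + y) + b                         ≡⟨ +-assoc (n ∸ m) (x + y) b ⟩
      n ∸ m + (x + y + b)                         ≡⟨ cong (n ∸ m +_) (+-comm (x + y) b) ⟩
      n ∸ m + (b + (x + y))                       ≡⟨ +-assoc (n ∸ m) b (x + y) ⟨
      n ∸ m + b + (x + y)                         ∎
      where open ≡-Reasoning

  window-complete : ∀ {i j} → n ∸ m ≤ i → b ≤ j → j < n →
    let x = i ∸ (n ∸ m) ; y = j ∸ b in
    Dominates o (f (n ∸ m + x) + prefix (suc y)) (f i + g j) × n ∸ m + b + (x + y) ≡ i + j
  window-complete {i} {j} ≤i b≤j j<n rewrite m+[n∸m]≡n ≤i =
    dom-+ o (dom-refl o) (prefix-dom b≤j (≤-reflexive (sym (m+[n∸m]≡n b≤j))) (<⇒≤pred j<n)) ,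
    index
    where
    index : n ∸ m + b + (i ∸ (n ∸ m) + (j ∸ b)) ≡ i + j
    index = begin
      n ∸ m + b + (i ∸ (n ∸ m) + (j ∸ b))     ≡⟨ interchange +-commutativeSemigroup (n ∸ m) b _ _ ⟩
      (n ∸ m + (i ∸ (n ∸ m))) + (b + (j ∸ b)) ≡⟨ cong₂ _+_ (m+[n∸m]≡n ≤i) (m+[n∸m]≡n b≤j) ⟩
      i + j                                   ∎
      where open ≡-Reasoning

≤∸1 : ∀ {n i} → i < n → i ≤ n ∸ 1
≤∸1 = <⇒≤pred

∸1< : ∀ {n i} → 1 ≤ n → i ≤ n ∸ 1 → i < n
∸1< {suc n} _ i≤ = s≤s i≤

2*∸1 : ∀ n {k} → 1 ≤ n → k ≤ (n ∸ 1) + (n ∸ 1) → k < 2 * n ∸ 1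
2*∸1 (suc n) _ k≤ rewrite +-identityʳ n | +-suc n n = s≤s k≤

<2*∸1 : ∀ n {k} → k < 2 * n ∸ 1 → k ≤ (n ∸ 1) + (n ∸ 1)
<2*∸1 (suc n) k< rewrite +-identityʳ n | +-suc n n = ≤-pred k<

-- Convolutions under index reversal

module Reflected (o : Extremum) (ρ : Bool) {n : ℕ} (1≤n : 1 ≤ n) (F G C : Store) where

  top : ℕ
  top = n ∸ 1

  convolution-sound : IsConvolution o {n} (F ∘ toℕ) (G ∘ toℕ) (C ∘ toℕ) → ∀ {k} → k ≤ top + top →
    ∃₂ λ x y → x < n × y < n × x + y ≡ k ×
      F (mirror ρ top x) + G (mirror ρ top y) ≡ C (mirror ρ (top + top) k)
  convolution-sound conv {k} k≤ with proj₁ (conv (fromℕ< (2*∸1 n 1≤n (mirror-≤ ρ k≤))))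
  ... | i , j , i+j≡ , eq =
    mirror ρ top (toℕ i) , mirror ρ top (toℕ j) ,
    mirror-< ρ (toℕ<n i) , mirror-< ρ (toℕ<n j) ,
    trans (mirror-+ ρ i≤ j≤)
      (trans (cong (mirror ρ (top + top)) (trans i+j≡ (toℕ-fromℕ< _))) (mirror-involutive ρ k≤)) ,
    trans (cong₂ (λ x y → F x + G y) (mirror-involutive ρ i≤) (mirror-involutive ρ j≤))
      (trans eq (cong C (toℕ-fromℕ< _)))
    where
    i≤ = ≤∸1 (toℕ<n i)
    j≤ = ≤∸1 (toℕ<n j)

  convolution-complete : IsConvolution o {n} (F ∘ toℕ) (G ∘ toℕ) (C ∘ toℕ) → ∀ {x y} → x < n → y < n →
    Dominates o (C (mirror ρ (top + top) (x + y))) (F (mirror ρ top x) + G (mirror ρ top y))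
  convolution-complete conv {x} {y} x<n y<n = subst₂ (Dominates o)
    (cong C (toℕ-fromℕ< _)) (cong₂ (λ i j → F i + G j) (toℕ-fromℕ< _) (toℕ-fromℕ< _))
    (proj₂ (conv (fromℕ< (2*∸1 n 1≤n (mirror-≤ ρ (+-mono-≤ (≤∸1 x<n) (≤∸1 y<n))))))
      (fromℕ< (mirror-< ρ x<n)) (fromℕ< (mirror-< ρ y<n))
      (trans (cong₂ _+_ (toℕ-fromℕ< (mirror-< ρ x<n)) (toℕ-fromℕ< (mirror-< ρ y<n)))
        (trans (mirror-+ ρ (≤∸1 x<n) (≤∸1 y<n)) (sym (toℕ-fromℕ< _)))))

-- Invariants of the output array

module Problem (o : Extremum) (ρ : Bool) {n : ℕ} (1≤n : 1 ≤ n) (H₀ : Store) where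

  -- Memory layout: the inputs lie below `out`, the results start at `out`, and the simulated memory
  -- of the subroutine starts at `base`, which is `4n`.
  top out base : ℕ
  top  = n ∸ 1
  out  = n + n
  base = out + out

  -- The inputs, indexed so that a increases towards the extremum.
  a b : Store
  a i = H₀ (mirror ρ top i)
  b j = H₀ (n + mirror ρ top j)

  cell : ℕ → ℕ
  cell k = out + mirror ρ (top + top) k

  -- Domination instead of equality: a candidate built from a prefix optimum need not be a sum of
  -- two entries, but some sum for the same output index is at least as good.
  Attainable : ℕ → ℕ → Set
  Attainable p v = ∃₂ λ i j → i < n × j < n × p ≡ cell (i + j) × Dominates o (a i + b j) v

  Covered : Store → ℕ → ℕ → Set
  Covered H i j = Dominates o (H (cell (i + j))) (a i + b j)

  record Good (H : Store) : Set where
    field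
      input : ∀ {x} → x < out → H x ≡ H₀ x
      sound : ∀ {k} → k ≤ top + top → Attainable (out + k) (H (out + k))

  open Good public

  Solved : Assertion
  Solved _ H = Good H × (∀ {i j} → i < n → j < n → Covered H i j)

  Improves : Store → Store → Set
  Improves H H′ = ∀ {x} → x < base → Dominates o (H′ x) (H x)

  top+top< : top + top < out
  top+top< = ≤-trans (s≤s (+-monoʳ-≤ top (m∸n≤m n 1))) (subst (λ k → k + n ≤ out) (sym (m+[n∸m]≡n 1≤n)) ≤-refl)

  cell-≥ : ∀ {k} → out ≤ cell k
  cell-≥ = m≤m+n out _

  cell-< : ∀ {k} → k ≤ top + top → cell k < base
  cell-< k≤ = +-monoʳ-< out (≤-<-trans (mirror-≤ ρ k≤) top+top<)

  pair-≤ : ∀ {i j} → i < n → j < n → i + j ≤ top + top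
  pair-≤ i<n j<n = +-mono-≤ (≤∸1 i<n) (≤∸1 j<n)

  covered-improves : ∀ {H H′ i j} → i < n → j < n → Improves H H′ → Covered H i j → Covered H′ i j
  covered-improves i<n j<n imp cov = dom-trans o (imp (cell-< (pair-≤ i<n j<n))) cov

  good-low : ∀ {H H′} → (∀ {x} → x < base → H′ x ≡ H x) → Good H → Good H′
  good-low low good .input x<out = trans (low (<-≤-trans x<out (m≤m+n out out))) (input good x<out)
  good-low low good .sound {k} k≤ = subst (Attainable (out + k))
    (sym (low (+-monoʳ-< out (≤-<-trans k≤ top+top<)))) (sound good k≤)

  improves-low : ∀ {H H′} → (∀ {x} → x < base → H′ x ≡ H x) → Improves H H′
  improves-low {H} low {x} x< = subst (λ v → Dominates o v (H x)) (sym (low x<)) (dom-refl o)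

  improves-trans : ∀ {H H′ H″} → Improves H H′ → Improves H′ H″ → Improves H H″
  improves-trans imp imp′ x< = dom-trans o (imp′ x<) (imp x<)

  good-≔ : ∀ {H p v} → out ≤ p → Attainable p v → Good H → Good (H [ p ≔ best o (H p) v ])
  good-≔ {H} {p} out≤p att good .input x<out =
    trans (≔-other H (<⇒≢ (<-≤-trans x<out out≤p))) (input good x<out)
  good-≔ {H} {p} out≤p att good .sound {k} k≤ with out + k ≟ p
  ... | no _     = sound good k≤
  ... | yes refl = best-elim o (Attainable p) (sound good k≤) att

  improves-≔ : ∀ {H p v} → Improves H (H [ p ≔ best o (H p) v ])
  improves-≔ {H} {p} {v} {x} x< with x ≟ p
  ... | no _     = dom-refl o
  ... | yes refl = best-domˡ o (H p) v

  -- Soundness names a pair that dominates the entry, coverage says that the entry dominates this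
  -- very pair, and antisymmetry makes the two equal.
  finish : ∀ {H} → Good H → (∀ {i j} → i < n → j < n → Covered H i j) →
    IsConvolution o {n} (λ i → H₀ (toℕ i)) (λ j → H₀ (n + toℕ j)) (λ k → H (2 * n + toℕ k))
  finish {H} good cov k = attained , dominated
    where
    doubled : ∀ {x} → 2 * n + x ≡ out + x
    doubled {x} = cong (λ y → n + y + x) (+-identityʳ n)

    k≤ : toℕ k ≤ top + top
    k≤ = <2*∸1 n (toℕ<n k)

    attained : ∃₂ λ i j → toℕ i + toℕ j ≡ toℕ k × H₀ (toℕ i) + H₀ (n + toℕ j) ≡ H (2 * n + toℕ k)
    attained with sound good k≤
    ... | i , j , i<n , j<n , p≡ , dom =
      fromℕ< (mirror-< ρ i<n) , fromℕ< (mirror-< ρ j<n) ,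
      trans (cong₂ _+_ (toℕ-fromℕ< (mirror-< ρ i<n)) (toℕ-fromℕ< (mirror-< ρ j<n)))
        (trans (mirror-+ ρ (≤∸1 i<n) (≤∸1 j<n)) (sym (+-cancelˡ-≡ out _ _ p≡))) ,
      trans (cong₂ (λ x y → H₀ x + H₀ (n + y)) (toℕ-fromℕ< (mirror-< ρ i<n)) (toℕ-fromℕ< (mirror-< ρ j<n)))
        (trans (dom-antisym o dom (subst (λ p → Dominates o (H p) (a i + b j)) (sym p≡) (cov i<n j<n)))
          (cong H (sym doubled)))

    dominated : ∀ i j → toℕ i + toℕ j ≡ toℕ k →
      Dominates o (H (2 * n + toℕ k)) (H₀ (toℕ i) + H₀ (n + toℕ j))
    dominated i j i+j≡k = subst₂ (Dominates o)
      (cong H (trans (cong (out +_) (trans (cong (mirror ρ (top + top)) (mirror-+ ρ i≤ j≤))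
        (trans (mirror-involutive ρ (+-mono-≤ i≤ j≤)) i+j≡k))) (sym doubled)))
      (cong₂ (λ x y → H₀ x + H₀ (n + y)) (mirror-involutive ρ i≤) (mirror-involutive ρ j≤))
      (cov (mirror-< ρ (toℕ<n i)) (mirror-< ρ (toℕ<n j)))
      where
      i≤ = ≤∸1 (toℕ<n i)
      j≤ = ≤∸1 (toℕ<n j)

  -- Every entry starts with the pair (i , j) of largest i, which settles all
  -- pairs with i = n - 1.

  record Started (k : ℕ) (H : Store) : Set where
    field
      input : ∀ {x} → x < out → H x ≡ H₀ x
      rest  : ∀ {x} → base ≤ x → H x ≡ H₀ x
      first : ∀ {i} → i < k → H (cell i) ≡ a (clip i top) + b (i ∸ top)

  started-≔ : ∀ {k H p v} → k ≤ top + top → p ≡ cell k → v ≡ a (clip k top) + b (k ∸ top) →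
    Started k H → Started (suc k) (H [ p ≔ v ])
  started-≔ {k} {H} k≤ refl refl st = record
    { input = λ x< → trans (≔-other H (<⇒≢ (<-≤-trans x< cell-≥))) (Started.input st x<)
    ; rest  = λ ≤x → trans (≔-other H (λ eq → <⇒≱ (cell-< k≤) (≤-trans ≤x (≤-reflexive eq)))) (Started.rest st ≤x)
    ; first = λ {i} i<k+1 → first i i<k+1 }
    where
    first : ∀ i → i < suc k → (H [ cell k ≔ a (clip k top) + b (k ∸ top) ]) (cell i) ≡ a (clip i top) + b (i ∸ top)
    first i i<k+1 with i ≟ k
    ... | yes refl = ≔-same H (cell k)
    ... | no i≢k   = trans
      (≔-other H (λ eq → i≢k (mirror-injective ρ (≤-trans (≤-pred i<k+1) k≤) k≤ (+-cancelˡ-≡ out _ _ eq))))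
      (Started.first st (≤∧≢⇒< (≤-pred i<k+1) i≢k))

  started-good : ∀ {H} → Started (suc (top + top)) H → Good H
  started-good st .input = Started.input st
  started-good {H} st .sound {r} r≤ =
    clip k top , k ∸ top , ∸1< 1≤n (clip-≤ʳ k top) , ∸1< 1≤n (m≤n+o⇒m∸n≤o k top k≤) ,
    cong (out +_) (sym (trans (cong (mirror ρ (top + top)) index) (mirror-involutive ρ r≤))) ,
    subst (λ v → Dominates o (a (clip k top) + b (k ∸ top)) v)
      (trans (sym (Started.first st (s≤s k≤))) (cong (λ x → H (out + x)) (mirror-involutive ρ r≤))) (dom-refl o)
    where
    k = mirror ρ (top + top) r
    k≤ : k ≤ top + top
    k≤ = mirror-≤ ρ r≤
    index : clip k top + (k ∸ top) ≡ k
    index with ≤-total k top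
    ... | inj₁ k≤top = trans (cong₂ _+_ (clip-id k≤top) (m≤n⇒m∸n≡0 k≤top)) (+-identityʳ k)
    ... | inj₂ top≤k = trans (cong (_+ (k ∸ top)) (≤-antisym (clip-≤ʳ k top) (clip-≥ top≤k ≤-refl))) (m+[n∸m]≡n top≤k)

  started-covered : ∀ {H j} → Started (suc (top + top)) H → j < n → Covered H top j
  started-covered {H} {j} st j<n = subst (λ v → Dominates o v (a top + b j))
    (sym (trans (Started.first st (s≤s (+-monoʳ-≤ top (≤∸1 j<n))))
      (cong₂ (λ x y → a x + b y) (≤-antisym (clip-≤ʳ (top + j) top) (clip-≥ (m≤m+n top j) ≤-refl)) (m+n∸m≡n top j))))
    (dom-refl o)

-- Preparing one call and reading its answer

module Call (o : Extremum) (d : Direction) {n : ℕ} (1≤n : 1 ≤ n) (H₀ : Store) {M : ℕ}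
  (H₀≤M : ∀ {x} → x < n + n → H₀ x ≤ M)
  (a-improving : Improving o n (Problem.a o (reversal o d) 1≤n H₀))
  {m β E V : ℕ} (1≤m : 1 ≤ m) (m≤n : m ≤ n) (β<n : β < n) (M<V : M < V) where

  ρ : Bool
  ρ = reversal o d

  open Problem o ρ 1≤n H₀
  open Prefix o b top β
  open Window o a b a-improving m≤n β<n

  topm : ℕ
  topm = m ∸ 1

  β≤top : β ≤ top
  β≤top = ≤∸1 β<n

  b≤M : ∀ {j} → j ≤ top → b j ≤ M
  b≤M j≤ = H₀≤M (+-monoʳ-< n (mirror-< ρ (∸1< 1≤n j≤)))

  a≤M : ∀ {i} → i < n → a i ≤ M
  a≤M i<n = H₀≤M (<-≤-trans (mirror-< ρ i<n) (m≤m+n n n))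

  prefix≤M : ∀ i → prefix i ≤ M
  prefix≤M = prefix-≤ β≤top b≤M

  suffix< : ∀ {i} → i < m → n ∸ m + i < n
  suffix< i<m = subst (n ∸ m + _ <_) (m∸n+n≡m m≤n) (+-monoʳ-< (n ∸ m) i<m)

  -- The arguments are stored in mirrored order, which turns improving sequences into sequences
  -- monotone in direction `d`. `rest` keeps all further cells at their stale contents, which do not
  -- exceed the epoch and so provide the zeros that `Input` demands.
  record Filled (Hs : Store) (k : ℕ) (H : Store) : Set where
    field
      low    : ∀ {x} → x < base → H x ≡ Hs x
      rest   : ∀ {x} → m + m ≤ x → H (base + x) ≡ Hs (base + x)
      fresh  : ∀ x → H (base + x) < E + V
      firsts : ∀ {i} → i < k → H (base + mirror ρ topm i) ≡ a (n ∸ m + i) + E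
      second : ∀ {i} → i < k → H (base + (m + mirror ρ topm i)) ≡ prefix (suc i) + E

  open Filled

  filled-≔ : ∀ {Hs k H p q u v} → k < m →
    p ≡ base + mirror ρ topm k → u ≡ a (n ∸ m + k) + E →
    q ≡ base + (m + mirror ρ topm k) → v ≡ prefix (suc k) + E →
    Filled Hs k H → Filled Hs (suc k) ((H [ p ≔ u ]) [ q ≔ v ])
  filled-≔ {Hs} {k} {H} {p} {q} {u} {v} k<m p≡ u≡ q≡ v≡ fill = record
    { low    = λ x< → trans (H′-other (<⇒≢ (<-≤-trans x< (subst (base ≤_) (sym p≡) (m≤m+n base _))))
        (<⇒≢ (<-≤-trans x< (subst (base ≤_) (sym q≡) (m≤m+n base _))))) (low fill x<)
    ; rest   = λ ≤x → trans (H′-other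
        (λ eq → <⇒≱ (<-≤-trans κ<m (m≤m+n m m)) (≤-trans ≤x (≤-reflexive (+-cancelˡ-≡ base _ _ (trans eq p≡)))))
        (λ eq → <⇒≱ (+-monoʳ-< m κ<m) (≤-trans ≤x (≤-reflexive (+-cancelˡ-≡ base _ _ (trans eq q≡))))))
        (rest fill ≤x)
    ; fresh  = fresh′
    ; firsts = λ {i} → firsts′ i
    ; second = λ {i} → second′ i }
    where
    H′ = (H [ p ≔ u ]) [ q ≔ v ]
    κ = mirror ρ topm k

    κ<m : κ < m
    κ<m = mirror-< ρ k<m

    H′-other : ∀ {x} → x ≢ p → x ≢ q → H′ x ≡ H x
    H′-other x≢p x≢q = trans (≔-other (H [ p ≔ u ]) x≢q) (≔-other H x≢p)

    M+E< : ∀ {x} → x ≤ M → x + E < E + V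
    M+E< x≤M = subst (_< E + V) (+-comm E _) (+-monoʳ-< E (≤-<-trans x≤M M<V))

    fresh′ : ∀ x → H′ (base + x) < E + V
    fresh′ x with base + x ≟ q
    ... | yes _ = subst (_< E + V) (sym v≡) (M+E< (prefix≤M (suc k)))
    ... | no _ with base + x ≟ p
    ...   | yes _ = subst (_< E + V) (sym u≡) (M+E< (a≤M (suffix< k<m)))
    ...   | no _  = fresh fill x

    distinct : ∀ {i} → i < m → i ≢ k → mirror ρ topm i ≢ κ
    distinct i<m i≢k eq = i≢k (mirror-injective ρ (≤∸1 i<m) (≤∸1 k<m) eq)

    firsts′ : ∀ i → i < suc k → H′ (base + mirror ρ topm i) ≡ a (n ∸ m + i) + E
    firsts′ i i<k+1 with i ≟ k
    ... | yes refl = trans (≔-other (H [ p ≔ u ])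
        (λ eq → <⇒≱ κ<m (≤-trans (m≤m+n m κ) (≤-reflexive (sym (+-cancelˡ-≡ base _ _ (trans eq q≡)))))))
      (trans (cong (H [ p ≔ u ]) (sym p≡)) (trans (≔-same H p) u≡))
    ... | no i≢k = trans (H′-other
        (λ eq → distinct i<m i≢k (+-cancelˡ-≡ base _ _ (trans eq p≡)))
        (λ eq → <⇒≱ (mirror-< ρ i<m) (≤-trans (m≤m+n m κ) (≤-reflexive (sym (+-cancelˡ-≡ base _ _ (trans eq q≡)))))))
      (firsts fill i<k)
      where
      i<k = ≤∧≢⇒< (≤-pred i<k+1) i≢k
      i<m = <-trans i<k k<m

    second′ : ∀ i → i < suc k → H′ (base + (m + mirror ρ topm i)) ≡ prefix (suc i) + E
    second′ i i<k+1 with i ≟ k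
    ... | yes refl = trans (cong H′ (sym q≡)) (trans (≔-same (H [ p ≔ u ]) q) v≡)
    ... | no i≢k = trans (H′-other
        (λ eq → <⇒≱ κ<m (≤-trans (m≤m+n m _) (≤-reflexive (+-cancelˡ-≡ base _ _ (trans eq p≡)))))
        (λ eq → distinct i<m i≢k (+-cancelˡ-≡ m _ _ (+-cancelˡ-≡ base _ _ (trans eq q≡)))))
      (second fill i<k)
      where
      i<k = ≤∧≢⇒< (≤-pred i<k+1) i≢k
      i<m = <-trans i<k k<m

  view : Store → Store
  view H x = H (base + x) ∸ E

  view-first : ∀ {Hs H} → Filled Hs m H → ∀ {i} → i < m → view H (mirror ρ topm i) ≡ a (n ∸ m + i)
  view-first fill i<m = trans (cong (_∸ E) (firsts fill i<m)) (m+n∸n≡m _ E)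

  view-second : ∀ {Hs H} → Filled Hs m H → ∀ {i} → i < m → view H (m + mirror ρ topm i) ≡ prefix (suc i)
  view-second fill i<m = trans (cong (_∸ E) (second fill i<m)) (m+n∸n≡m _ E)

  bounded : ∀ {f : Store} → (∀ {i} → i < m → f (mirror ρ topm i) ≤ M) → ∀ {i} → i < m → f i ≤ M
  bounded {f} f≤ {i} i<m = subst (λ x → f x ≤ M) (mirror-involutive ρ (≤∸1 i<m)) (f≤ (mirror-< ρ i<m))

  module Prepared {Hs H : Store} (stale : ∀ x → Hs (base + x) ≤ E) (fill : Filled Hs m H) where

    X Y : Vector ℕ m
    X i = view H (toℕ i)
    Y j = view H (m + toℕ j)

    prepared-input : Input M X Y ⟨ 0 , arguments m M , view H ⟩
    prepared-input = record
      { pc-start = refl ; reg-n = refl ; reg-M = refl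
      ; reg-rest = λ where (suc (suc r)) _ → refl ; (suc zero) (s≤s ())
      ; mem-A    = λ _ → refl
      ; mem-B    = λ _ → refl
      ; mem-rest = λ x ≤x → trans (cong (_∸ E) (rest fill (subst (_≤ x) (cong (m +_) (+-identityʳ m)) ≤x)))
          (m≤n⇒m∸n≡0 (stale x)) }

    X≤M : ∀ i → X i ≤ M
    X≤M i = bounded {view H} (λ i<m → subst (_≤ M) (sym (view-first fill i<m)) (a≤M (suffix< i<m))) (toℕ<n i)

    Y≤M : ∀ i → Y i ≤ M
    Y≤M i = bounded {view H ∘ (m +_)}
      (λ {i} i<m → subst (_≤ M) (sym (view-second fill i<m)) (prefix≤M (suc i))) (toℕ<n i)

    X-monotone : Monotone d X
    X-monotone = ordered⇒monotone d (improving⇒ordered o d {f = view H} λ i≤j j<m →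
      subst₂ (Dominates o) (sym (view-first fill j<m)) (sym (view-first fill (≤-<-trans i≤j j<m)))
        (a-improving (+-monoʳ-≤ (n ∸ m) i≤j) (suffix< j<m)))

    Y-monotone : Monotone d Y
    Y-monotone = ordered⇒monotone d (improving⇒ordered o d {f = view H ∘ (m +_)} λ i≤j j<m →
      subst₂ (Dominates o) (sym (view-second fill j<m)) (sym (view-second fill (≤-<-trans i≤j j<m)))
        (prefix-mono (s≤s i≤j)))

    module Answered {S : Store} (conv : IsConvolution o X Y (λ k → S (2 * m + toℕ k))) where

      open Reflected o ρ 1≤m (view H) (view H ∘ (m +_)) (S ∘ (2 * m +_))
        using (convolution-sound; convolution-complete)

      answer : ℕ → ℕ
      answer k = S (2 * m + mirror ρ (topm + topm) k)

      answer-attainable : ∀ {k} → k < m → Attainable (cell (n ∸ m + β + k)) (answer k)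
      answer-attainable {k} k<m with convolution-sound conv (≤-trans (≤∸1 k<m) (m≤m+n topm topm))
      ... | x , y , x<m , y<m , refl , eq with window-sound {x} {y} k<m
      ...   | i , j , i<n , j<n , i+j≡ , dom = i , j , i<n , j<n , cong cell (sym i+j≡) ,
        subst (Dominates o (a i + b j))
          (trans (sym (cong₂ _+_ (view-first fill x<m) (view-second fill y<m))) eq) dom

      answer-dominates : ∀ {i j} → i < n → j < n → n ∸ m ≤ i → β ≤ j →
        let k = (i ∸ (n ∸ m)) + (j ∸ β) in k < m →
        Dominates o (answer k) (a i + b j) × n ∸ m + β + k ≡ i + j
      answer-dominates {i} {j} i<n j<n ≤i β≤j k<m with window-complete ≤i β≤j j<n
      ... | dom , index = dom-trans o (subst (Dominates o _)
        (cong₂ _+_ (view-first fill (≤-<-trans (m≤m+n _ _) k<m)) (view-second fill (≤-<-trans (m≤n+m _ _) k<m)))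
        (convolution-complete conv (≤-<-trans (m≤m+n _ _) k<m) (≤-<-trans (m≤n+m _ _) k<m))) dom , index

      -- `high` ensures that merging answers into the output leaves intact the simulated memory from
      -- which the later answers are still to be read.
      record Read (Hr : Store) (k : ℕ) (H : Store) : Set where
        field
          good     : Good H
          improves : Improves Hr H
          high     : ∀ x → H (base + x) ≡ Hr (base + x)
          done     : ∀ {i} → i < k → Dominates o (H (cell (n ∸ m + β + i))) (answer i)

      open Read public

      -- Even when a window runs past the end of the second input, its `m` entries stay inside the
      -- output, because the window starts at `β ≤ top` and the last used index of the first input
      -- is `top`.
      target≤ : ∀ {k} → k < m → n ∸ m + β + k ≤ top + top
      target≤ {k} k<m = begin
        n ∸ m + β + k     ≤⟨ +-mono-≤ (+-monoʳ-≤ (n ∸ m) β≤top) (≤∸1 k<m) ⟩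
        n ∸ m + top + topm ≡⟨ cong (_+ topm) (+-comm (n ∸ m) top) ⟩
        top + (n ∸ m) + topm ≡⟨ +-assoc top (n ∸ m) topm ⟩
        top + (n ∸ m + topm) ≤⟨ +-monoʳ-≤ top (≤∸1 (suffix< (∸1< 1≤m ≤-refl))) ⟩
        top + top         ∎
        where open ≤-Reasoning

      read-≔ : ∀ {Hr k H p v} → k < m → p ≡ cell (n ∸ m + β + k) → v ≡ best o (H p) (answer k) →
        Read Hr k H → Read Hr (suc k) (H [ p ≔ v ])
      read-≔ {Hr} {k} {H} k<m refl refl rd = record
        { good     = good-≔ cell-≥ (answer-attainable k<m) (good rd)
        ; improves = improves-trans {H′ = H} (improves rd) (improves-≔ {H})
        ; high     = λ x → trans
            (≔-other H (λ eq → <⇒≱ (cell-< (target≤ k<m)) (≤-trans (m≤m+n base x) (≤-reflexive eq))))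
            (high rd x)
        ; done     = λ {i} → done′ i }
        where
        p = cell (n ∸ m + β + k)
        done′ : ∀ i → i < suc k → Dominates o ((H [ p ≔ best o (H p) (answer k) ]) (cell (n ∸ m + β + i))) (answer i)
        done′ i i<k+1 with i ≟ k
        ... | yes refl = subst (λ v → Dominates o v (answer k)) (sym (≔-same H p)) (best-domʳ o (H p) (answer k))
        ... | no i≢k   = dom-trans o
          (improves-≔ {H} {p} {answer k} (cell-< (target≤ (<-trans i<k k<m)))) (done rd i<k)
          where i<k = ≤∧≢⇒< (≤-pred i<k+1) i≢k

      read-covered : ∀ {Hr H i j} → Read Hr m H → i < n → j < n → n ∸ m ≤ i → β ≤ j →
        (i ∸ (n ∸ m)) + (j ∸ β) < m → Covered H i j
      read-covered {H = H} {i} {j} rd i<n j<n ≤i β≤j k<m with answer-dominates i<n j<n ≤i β≤j k<m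
      ... | dom , index = dom-trans o
        (subst (λ k → Dominates o (H (cell k)) (answer ((i ∸ (n ∸ m)) + (j ∸ β)))) index (done rd k<m)) dom

copy : ℕ → ℕ → Atom
copy r x = flip false r x x

-- The program and its correctness

module Text (o : Extremum) (ρ : Bool) (P : Program) (w : ℕ) where

  -- Computes the epoch increment as a power of `n + M + 2`. The text is instantiated with one more
  -- than the exponent of the subroutine's word bound, so that the increment exceeds `M` even if
  -- that exponent is 0.
  power : List Atom
  power = bin add rX rN rM ∷ set rY 2 ∷ bin add rX rX rY ∷ set rV 1 ∷
    replicate w (bin mul rV rX rV)

  setup : List Atom
  setup =
    set rOne 1 ∷ bin add rOut rN rN ∷ bin add rBase rOut rOut ∷
    bin sub rTop rN rOne ∷ bin add rTop2 rTop rTop ∷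
    bin add rLim rTop2 rOne ∷ set rI 0 ∷ copy rGo rLim ∷ []

  start : List Atom
  start =
    better min-plus rX rI rTop ∷ flip ρ rX rTop rX ∷ get rX rX ∷
    bin sub rY rI rTop ∷ flip ρ rY rTop rY ∷ bin add rY rN rY ∷ get rY rY ∷
    bin add rX rX rY ∷
    flip ρ rY rTop2 rI ∷ bin add rY rOut rY ∷ put rY rX ∷
    bin add rI rI rOne ∷ bin sub rGo rLim rI ∷ []

  enter-levels : List Atom
  enter-levels = copy rSize rN ∷ bin sub rLev rSize rOne ∷ []

  enter-level : List Atom
  enter-level =
    bin add rHalf rSize rOne ∷ set rX 2 ∷ bin div rHalf rHalf rX ∷
    bin sub rTopm rSize rOne ∷ bin add rTopm2 rTopm rTopm ∷ bin sub rOff rN rSize ∷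
    bin add rPB rBase rSize ∷ bin add rPOut rPB rSize ∷ copy rLim rSize ∷
    set rB 0 ∷ copy rWin rN ∷ []

  leave-level : List Atom
  leave-level = copy rSize rHalf ∷ bin sub rLev rSize rOne ∷ []

  enter-window : List Atom
  enter-window =
    bin add rE rE rV ∷ flip ρ rX rTop rB ∷ bin add rX rN rX ∷ get rAcc rX ∷
    set rI 0 ∷ copy rGo rSize ∷ []

  fill : List Atom
  fill =
    bin add rX rB rI ∷ better min-plus rX rX rTop ∷ flip ρ rX rTop rX ∷ bin add rX rN rX ∷
    get rX rX ∷ better o rAcc rAcc rX ∷
    bin add rX rOff rI ∷ flip ρ rX rTop rX ∷ get rX rX ∷ bin add rX rX rE ∷
    flip ρ rY rTopm rI ∷ bin add rY rBase rY ∷ put rY rX ∷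
    bin add rX rAcc rE ∷
    flip ρ rY rTopm rI ∷ bin add rY rPB rY ∷ put rY rX ∷
    bin add rI rI rOne ∷ bin sub rGo rLim rI ∷ []

  rewind : List Atom
  rewind = set rI 0 ∷ copy rGo rLim ∷ []

  fetch-answer : List Atom
  fetch-answer =
    flip ρ rX rTopm2 rI ∷ bin add rX rPOut rX ∷ get rX rX ∷ bin sub rX rX rE ∷
    bin add rY rOff rB ∷ bin add rY rY rI ∷ flip ρ rY rTop2 rY ∷ bin add rY rOut rY ∷
    get rAcc rY ∷ better o rAcc rAcc rX ∷ put rY rAcc ∷
    bin add rI rI rOne ∷ bin sub rGo rLim rI ∷ []

  leave-window : List Atom
  leave-window = bin add rB rB rHalf ∷ bin sub rWin rN rB ∷ []

  window : Code
  window = block enter-window ⨾ while rGo (block fill) ⨾ call P ⨾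
    block rewind ⨾ while rGo (block fetch-answer) ⨾ block leave-window

  window-cost : ℕ → ℕ → ℕ
  window-cost t m = cost enter-window + (m * (2 + cost fill) + 1 + (registers P + 4 + t * 3 +
    (cost rewind + (m * (2 + cost fetch-answer) + 1 + cost leave-window))))

  -- `q` counts the subproblems of the level in the recurrence, with `n ≤ q * m`. Windows advance by
  -- half of `m`, rounded up, so `q * 2` of them suffice.
  level-cost : ℕ → ℕ → ℕ → ℕ
  level-cost q t m = cost enter-level + (q * 2 * (2 + window-cost t m) + 1 + cost leave-level)

  level : Code
  level = block enter-level ⨾ while rWin window ⨾ block leave-level

  body : Code
  body = block power ⨾ block setup ⨾ while rGo (block start) ⨾ block enter-levels ⨾ while rLev level

  -- The outer loop is a conditional: its body resets `rMain`, hence runs once if `M` is nonzero and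
  -- not at all otherwise.
  program : Code
  program = block (copy rMain rM ∷ []) ⨾ while rMain (body ⨾ block (set rMain 0 ∷ []))

-- Halving and the recurrence

/2≡⌊/2⌋ : ∀ m → m / 2 ≡ ⌊ m /2⌋
/2≡⌊/2⌋ 0 = refl
/2≡⌊/2⌋ 1 = refl
/2≡⌊/2⌋ (suc (suc m)) = trans (m/n≡1+[m∸n]/n {suc (suc m)} {2} (s≤s (s≤s z≤n))) (cong suc (/2≡⌊/2⌋ m))

-- The recurrence for T₁, unfolded at most f times; f = m suffices.
time : (c : ℕ) (T : ℕ → ℕ → ℕ) (f m M : ℕ) → ℕ
time c T zero    m             M = c
time c T (suc f) 0             M = c
time c T (suc f) 1             M = c
time c T (suc f) (suc (suc m)) M = 2 * time c T f ⌈ suc (suc m) /2⌉ M + c * T (suc (suc m)) M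

⌈/2⌉-fuel : ∀ {m f} → suc (suc m) ≤ suc f → ⌈ suc (suc m) /2⌉ ≤ f
⌈/2⌉-fuel {m} m≤f = ≤-pred (≤-trans (⌈n/2⌉<n m) m≤f)

time-fuel : ∀ c T {f g} m M → m ≤ f → m ≤ g → time c T f m M ≡ time c T g m M
time-fuel c T {zero}  {zero}  _             M _   _   = refl
time-fuel c T {zero}  {suc g} 0             M _   _   = refl
time-fuel c T {suc f} {zero}  0             M _   _   = refl
time-fuel c T {suc f} {suc g} 0             M _   _   = refl
time-fuel c T {suc f} {suc g} 1             M _   _   = refl
time-fuel c T {suc f} {suc g} (suc (suc m)) M m≤f m≤g =
  cong (λ t → 2 * t + c * T (suc (suc m)) M) (time-fuel c T _ M (⌈/2⌉-fuel m≤f) (⌈/2⌉-fuel m≤g))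

time-mono : ∀ {c c′} T f m M → c ≤ c′ → time c T f m M ≤ time c′ T f m M
time-mono T zero    m             M c≤ = c≤
time-mono T (suc f) 0             M c≤ = c≤
time-mono T (suc f) 1             M c≤ = c≤
time-mono T (suc f) (suc (suc m)) M c≤ =
  +-mono-≤ (*-monoʳ-≤ 2 (time-mono T f _ M c≤)) (*-monoˡ-≤ (T (suc (suc m)) M) c≤)

time-≥c : ∀ c T f m M → c ≤ time c T f m M
time-≥c c T zero    m             M = ≤-refl
time-≥c c T (suc f) 0             M = ≤-refl
time-≥c c T (suc f) 1             M = ≤-refl
time-≥c c T (suc f) (suc (suc m)) M =
  ≤-trans (time-≥c c T f _ M) (≤-trans (m≤m+n _ _) (m≤m+n _ (c * T (suc (suc m)) M)))

-- Used twice: it bounds the number of windows on a level, and it passes the invariant `n ≤ q * m`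
-- on to the next level with `q` doubled.
halving : ∀ q m → q * m ≤ q * 2 * ⌈ m /2⌉
halving q m = begin
  q * m                     ≡⟨ cong (q *_) (⌊n/2⌋+⌈n/2⌉≡n m) ⟨
  q * (⌊ m /2⌋ + ⌈ m /2⌉)   ≤⟨ *-monoʳ-≤ q (+-monoˡ-≤ ⌈ m /2⌉ (⌊n/2⌋≤⌈n/2⌉ m)) ⟩
  q * (⌈ m /2⌉ + ⌈ m /2⌉)   ≡⟨ cong (λ x → q * (⌈ m /2⌉ + x)) (+-identityʳ ⌈ m /2⌉) ⟨
  q * (2 * ⌈ m /2⌉)         ≡⟨ *-assoc q 2 ⌈ m /2⌉ ⟨
  q * 2 * ⌈ m /2⌉           ∎
  where open ≤-Reasoning

-- Loop invariants and total cost for positive `M`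

module Correct (o : Extremum) (d : Direction) (T₂ : ℕ → ℕ → ℕ) (P : Program)
  (subroutine : ComputesInTime o (λ A B → Monotone d A × Monotone d B) T₂ P)
  {n M : ℕ} (1≤n : 1 ≤ n) (1≤M : 1 ≤ M) (H₀ : Store)
  (H₀≤M : ∀ {x} → x < n + n → H₀ x ≤ M)
  (H₀-rest : ∀ {x} → n + n ≤ x → H₀ x ≡ 0)
  (a-improving : Improving o n (Problem.a o (reversal o d) 1≤n H₀))
  (V X W : ℕ)
  (V≡ : V ≡ (n + M + 2) ^ suc (proj₁ subroutine))
  (base+n≤X : (n + n) + (n + n) + n + n ≤ X) (N≤X : n + M + 2 ≤ X) (V≤X : V ≤ X) (nnV≤X : n * (n * V) ≤ X)
  (2X<W : X + X < W) where

  w = proj₁ subroutine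
  ρ = reversal o d

  open Text o ρ P (suc w)
  open Problem o ρ 1≤n H₀

  -- Each `bin add` of the host text outside `power` has operands of size at most `X`, so this
  -- settles its overflow check.
  +< : ∀ {x y} → x ≤ X → y ≤ X → x + y < W
  +< x≤X y≤X = ≤-<-trans (+-mono-≤ x≤X y≤X) 2X<W

  base≤X : base ≤ X
  base≤X = ≤-trans (≤-trans (m≤m+n base n) (m≤m+n (base + n) n)) base+n≤X

  1≤X : 1 ≤ X
  1≤X = ≤-trans (≤-trans (m≤n+m 1 (n + M + 1)) (≤-reflexive (+-assoc (n + M) 1 1))) N≤X

  X<W : X < W
  X<W = ≤-<-trans (m≤m+n X X) 2X<W

  out≤X : out ≤ X
  out≤X = ≤-trans (m≤m+n out out) base≤X

  n≤X : n ≤ X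
  n≤X = ≤-trans (m≤m+n n n) out≤X

  M≤X : M ≤ X
  M≤X = ≤-trans (≤-trans (m≤n+m M n) (m≤m+n (n + M) 2)) N≤X

  N>0 : 0 < n + M + 2
  N>0 = ≤-trans (s≤s z≤n) (m≤n+m 2 (n + M))

  M<V : M < V
  M<V = ≤-trans (subst (suc M ≤_) (+-comm 2 (n + M)) (s≤s (m≤n⇒m≤1+n (m≤n+m M n))))
    (≤-trans (m≤m*n (n + M + 2) ((n + M + 2) ^ w) {{m^n≢0 (n + M + 2) w {{>-nonZero N>0}}}}) (≤-reflexive (sym V≡)))

  top≤n : top ≤ n
  top≤n = m∸n≤m n 1

  top≤X : top ≤ X
  top≤X = ≤-trans top≤n n≤X

  top+top≤X : top + top ≤ X
  top+top≤X = ≤-trans (+-mono-≤ top≤n top≤n) out≤X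

  Global : Store → Set
  Global R = R rN ≡ n × R rM ≡ M × R rOne ≡ 1 × R rV ≡ V × R rBase ≡ base ×
    R rTop ≡ top × R rTop2 ≡ top + top × R rOut ≡ out

  module AtLevel {m : ℕ} (1≤m : 1 ≤ m) (m≤n : m ≤ n) where

    h = ⌈ m /2⌉

    Local : Store → Set
    Local R = Global R × R rSize ≡ m × R rHalf ≡ h × R rTopm ≡ m ∸ 1 × R rTopm2 ≡ (m ∸ 1) + (m ∸ 1) ×
      R rOff ≡ n ∸ m × R rPB ≡ base + m × R rPOut ≡ base + m + m × R rLim ≡ m

    m≤X : m ≤ X
    m≤X = ≤-trans m≤n n≤X

    module InWindow {β E₀ : ℕ} (β<n : β < n) (E₀+V≤X : E₀ + V ≤ X) where

      E = E₀ + V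

      open Call o d 1≤n H₀ H₀≤M a-improving {m} {β} {E} {V} 1≤m m≤n β<n M<V hiding (ρ)
      open Prefix o b top β
      open Filled

      Here : Store → Set
      Here R = Local R × R rB ≡ β × R rE ≡ E

      record Filling (Hs : Store) (k : ℕ) (R H : Store) : Set where
        field
          {i}    : ℕ
          here   : Here R
          i≡     : R rI ≡ i
          go≡    : R rGo ≡ k
          i+k≡m  : i + k ≡ m
          acc≡   : R rAcc ≡ prefix i
          filled : Filled Hs i H

      open Filling

      κ : ℕ → ℕ
      κ = mirror ρ topm

      E≤X : E ≤ X
      E≤X = E₀+V≤X

      β≤X : β ≤ X
      β≤X = ≤-trans (<⇒≤ β<n) n≤X

      lookup-a : ∀ {Hs H : Store} {p i} → Good Hs → (∀ {x} → x < base → H x ≡ Hs x) → i < n →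
        p ≡ mirror ρ top i → H p ≡ a i
      lookup-a good low i<n refl = trans (low (<-≤-trans p< (m≤m+n out out))) (input good p<)
        where p< = <-≤-trans (mirror-< ρ i<n) (m≤m+n n n)

      lookup-b : ∀ {Hs H : Store} {p j} → Good Hs → (∀ {x} → x < base → H x ≡ Hs x) → j ≤ top →
        p ≡ n + mirror ρ top j → H p ≡ b j
      lookup-b good low j≤top refl = trans (low (<-≤-trans p< (m≤m+n out out))) (input good p<)
        where p< = +-monoʳ-< n (mirror-< ρ (∸1< 1≤n j≤top))

      -- The tuple follows the atoms of `fill` one by one: the value written, the reason for it and,
      -- where required, the word bound. Its last component is the invariant for the next round.
      fill-ends : ∀ {Hs k R H} → Good Hs → Filling Hs (suc k) R H →
        Ends W (block fill) R H (cost fill) (Filling Hs k)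
      fill-ends {Hs} {k} {R} {H} good F
        with ((eN , _ , eOne , _ , eBase , eTop , _ , _) ,
              _ , _ , eTopm , _ , eOff , ePB , _ , eLim) , eB , eE ← here F =
        straight fill
          ( _ , cong₂ _+_ eB (i≡ F) , +< β≤X i≤X
          , λ _ → refl
          , _ , cong (clip (β + i F)) eTop
          , _ , cong (λ t → mirror ρ t (clip (β + i F) top)) eTop
          , _ , cong (_+ mirror ρ top (clip (β + i F) top)) eN
          , +< n≤X (≤-trans (mirror-≤ ρ (clip-≤ʳ (β + i F) top)) top≤X)
          , _ , lookup-b {Hs} {H} good (low (filled F)) (clip-≤ʳ (β + i F) top) refl
          , λ _ → refl
          , _ , cong (λ x → best o x (b (clip (β + i F) top))) (acc≡ F)
          , _ , cong₂ _+_ eOff (i≡ F) , +< (≤-trans (m∸n≤m n m) n≤X) i≤X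
          , _ , cong (λ t → mirror ρ t (n ∸ m + i F)) eTop
          , _ , lookup-a {Hs} {H} good (low (filled F)) (suffix< i<m) refl
          , _ , cong (a (n ∸ m + i F) +_) eE , +< (≤-trans (a≤M (suffix< i<m)) M≤X) E≤X
          , _ , cong₂ (mirror ρ) eTopm (i≡ F)
          , _ , cong (_+ κ (i F)) eBase , +< base≤X κ≤X
          , _ , _ , refl , refl
          , _ , cong (prefix (suc (i F)) +_) eE , +< (≤-trans (prefix≤M (suc (i F))) M≤X) E≤X
          , _ , cong₂ (mirror ρ) eTopm (i≡ F)
          , _ , cong (_+ κ (i F)) ePB , +< base+m≤X κ≤X
          , _ , _ , refl , refl
          , _ , suc-i , subst (_< W) (+-comm (i F) 1) (+< i≤X 1≤X)
          , _ , cong (_∸ suc (i F)) eLim , tt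
          , record
            { here   = here F
            ; i≡     = refl
            ; go≡    = trans (cong (_∸ suc (i F)) (sym i+k≡m′)) (m+n∸m≡n (suc (i F)) k)
            ; i+k≡m  = i+k≡m′
            ; acc≡   = refl
            ; filled = filled-≔ {Hs} i<m refl refl (+-assoc base m _) refl (filled F) } )
        where
        i+k≡m′ : suc (i F) + k ≡ m
        i+k≡m′ = trans (sym (+-suc (i F) k)) (i+k≡m F)
        i<m : i F < m
        i<m = subst (suc (i F) ≤_) i+k≡m′ (m≤m+n _ k)
        i≤X : i F ≤ X
        i≤X = ≤-trans (<⇒≤ i<m) m≤X
        κ≤X : κ (i F) ≤ X
        κ≤X = ≤-trans (<⇒≤ (mirror-< ρ i<m)) m≤X
        base+m≤X : base + m ≤ X
        base+m≤X = ≤-trans (≤-trans (+-monoʳ-≤ base m≤n) (m≤m+n (base + n) n)) base+n≤X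
        suc-i : R rI + R rOne ≡ suc (i F)
        suc-i = trans (cong₂ _+_ (i≡ F) eOne) (+-comm (i F) 1)

      module Answering {Hs Hf : Store} (stale : ∀ x → Hs (base + x) ≤ E) (fill : Filled Hs m Hf) {S : Store}
        (conv : IsConvolution o (Prepared.X stale fill) (Prepared.Y stale fill) (λ k → S (2 * m + toℕ k))) where

        open Prepared stale fill using (module Answered)
        open Answered {S} conv

        record Reading (Hr : Store) (k : ℕ) (R H : Store) : Set where
          field
            {i}   : ℕ
            here  : Here R
            i≡    : R rI ≡ i
            go≡   : R rGo ≡ k
            i+k≡m : i + k ≡ m
            read  : Read Hr i H

        open Reading

        reading-ends : ∀ {Hr k R H} → (∀ x → Hr (base + x) ∸ E ≡ S x) → Reading Hr (suc k) R H →
          Ends W (block fetch-answer) R H (cost fetch-answer) (Reading Hr k)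
        reading-ends {Hr} {k} {R} {H} cells F
          with ((_ , _ , eOne , _ , _ , _ , eTop2 , eOut) ,
                _ , _ , _ , eTopm2 , eOff , _ , ePOut , eLim) , eB , eE ← here F =
          straight fetch-answer
            ( _ , cong₂ (mirror ρ) eTopm2 (i≡ F)
            , _ , cong (_+ μ) ePOut , +< base+m+m≤X μ≤X
            , _ , refl
            , _ , trans (cong (H (base + m + m + μ) ∸_) eE) answer≡ , tt
            , _ , cong₂ _+_ eOff eB , +< (≤-trans (m∸n≤m n m) n≤X) β≤X
            , _ , cong (n ∸ m + β +_) (i≡ F)
            , +< (≤-trans (m≤m+n _ (i F)) target≤X) (≤-trans (m≤n+m (i F) _) target≤X)
            , _ , cong (λ t → mirror ρ t target) eTop2
            , _ , cong (_+ mirror ρ (top + top) target) eOut , +< out≤X (≤-trans (mirror-≤ ρ (target≤ i<m)) top+top≤X)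
            , _ , refl
            , λ _ → refl
            , _ , refl
            , _ , _ , refl , refl
            , _ , suc-i , subst (_< W) (+-comm (i F) 1) (+< i≤X 1≤X)
            , _ , cong (_∸ suc (i F)) eLim , tt
            , record
              { here  = here F
              ; i≡    = refl
              ; go≡   = trans (cong (_∸ suc (i F)) (sym i+k≡m′)) (m+n∸m≡n (suc (i F)) k)
              ; i+k≡m = i+k≡m′
              ; read  = read-≔ i<m refl refl (read F) } )
          where
          target = n ∸ m + β + i F
          μ = mirror ρ (topm + topm) (i F)
          i+k≡m′ : suc (i F) + k ≡ m
          i+k≡m′ = trans (sym (+-suc (i F) k)) (i+k≡m F)
          i<m : i F < m
          i<m = subst (suc (i F) ≤_) i+k≡m′ (m≤m+n _ k)
          i≤X : i F ≤ X
          i≤X = ≤-trans (<⇒≤ i<m) m≤X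
          target≤X : target ≤ X
          target≤X = ≤-trans (target≤ i<m) top+top≤X
          suc-i : R rI + R rOne ≡ suc (i F)
          suc-i = trans (cong₂ _+_ (i≡ F) eOne) (+-comm (i F) 1)
          base+m+m≤X : base + m + m ≤ X
          base+m+m≤X = ≤-trans (+-mono-≤ (+-monoʳ-≤ base m≤n) m≤n) base+n≤X
          μ≤X : μ ≤ X
          μ≤X = ≤-trans (mirror-≤ ρ (≤-trans (≤∸1 i<m) (m≤m+n topm topm)))
            (≤-trans (+-mono-≤ (≤-trans (m∸n≤m m 1) m≤n) (≤-trans (m∸n≤m m 1) m≤n)) out≤X)
          answer≡ : H (base + m + m + μ) ∸ E ≡ answer (i F)
          answer≡ = trans (cong (_∸ E) (trans (cong H address) (high (read F) _))) (cells (2 * m + μ))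
            where
            address : base + m + m + μ ≡ base + (2 * m + μ)
            address = trans (cong (_+ μ) (+-assoc base m m)) (trans (+-assoc base (m + m) μ)
              (cong (λ y → base + (m + y + μ)) (sym (+-identityʳ m))))

      record WindowDone (Hs R H : Store) : Set where
        field
          local    : Local R
          b≡       : R rB ≡ β + h
          E≡       : R rE ≡ E
          win≡     : R rWin ≡ n ∸ (β + h)
          good     : Good H
          improves : Improves Hs H
          fresh    : ∀ x → H (base + x) < E + V
          covered  : ∀ {i j} → i < n → j < n → n ∸ m ≤ i → β ≤ j →
            (i ∸ (n ∸ m)) + (j ∸ β) < m → Covered H i j

      here-frame : ∀ {R R′} → (∀ {r} → r < 28 → R′ r ≡ R r) → Here R → Here R′
      here-frame own (((e₁ , e₂ , e₃ , e₄ , e₅ , e₆ , e₇ , e₈) , f₁ , f₂ , f₃ , f₄ , f₅ , f₆ , f₇ , f₈) , g₁ , g₂) =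
        ((trans (own <!) e₁ , trans (own <!) e₂ , trans (own <!) e₃ , trans (own <!) e₄ ,
          trans (own <!) e₅ , trans (own <!) e₆ , trans (own <!) e₇ , trans (own <!) e₈) ,
          trans (own <!) f₁ , trans (own <!) f₂ , trans (own <!) f₃ , trans (own <!) f₄ ,
          trans (own <!) f₅ , trans (own <!) f₆ , trans (own <!) f₇ , trans (own <!) f₈) ,
        trans (own <!) g₁ , trans (own <!) g₂

      here-M : ∀ R → Here R → R rM ≡ M
      here-M R (((_ , e , _) , _) , _) = e

      here-base : ∀ R → Here R → R rBase ≡ base
      here-base R (((_ , _ , _ , _ , e , _) , _) , _) = e

      here-size : ∀ R → Here R → R rSize ≡ m
      here-size R ((_ , e , _) , _) = e

      here-lim : ∀ R → Here R → R rLim ≡ m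
      here-lim R ((_ , _ , _ , _ , _ , _ , _ , _ , e) , _) = e

      here-E : ∀ R → Here R → R rE ≡ E
      here-E R (_ , _ , e) = e

      window-ends : ∀ {R H} → Local R → R rB ≡ β → R rE ≡ E₀ → Good H → (∀ x → H (base + x) < E₀ + V) →
        Ends W window R H (window-cost (T₂ m M) m) (WindowDone H)
      window-ends {R} {H} local@((eN , eM , eOne , eV , eBase , eTop , eTop2 , eOut) , eSize , _) eB eE good fresh₀ =
        seq {c = block enter-window} (straight enter-window
          ( _ , cong₂ _+_ eE eV , +< (≤-trans (m≤m+n E₀ V) E₀+V≤X) V≤X
          , _ , cong₂ (mirror ρ) eTop eB
          , _ , cong (_+ mirror ρ top β) eN , +< n≤X (≤-trans (mirror-≤ ρ β≤top) top≤X)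
          , _ , lookup-b {H} {H} good (λ _ → refl) β≤top refl
          , ≤-<-trans z≤n X<W
          , _ , eSize
          , seq {c = while rGo (block fill)} (weaken ≤-refl rewind⇒
              (while-count (Filling H) go≡ (λ F _ → fill-ends good F) m record
                { here = local , eB , refl ; i≡ = refl ; go≡ = refl ; i+k≡m = refl ; acc≡ = refl
                ; filled = record
                  { low = λ _ → refl ; rest = λ _ → refl
                  ; fresh = λ x → <-≤-trans (fresh₀ x) (m≤m+n E V)
                  ; firsts = λ () ; second = λ () } }))))
        where
        stale : ∀ x → H (base + x) ≤ E
        stale x = <⇒≤ (fresh₀ x)

        tail : Code
        tail = call P ⨾ block rewind ⨾ while rGo (block fetch-answer) ⨾ block leave-window

        tail-cost : ℕ
        tail-cost = registers P + 4 + T₂ m M * 3 +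
          (cost rewind + (m * (2 + cost fetch-answer) + 1 + cost leave-window))

        module Called {R₁ H₁ : Store} (here₁ : Here R₁) (fill : Filled H m H₁) where

          open Prepared stale fill renaming (X to X′; Y to Y′)

          call-subroutine : Ends W tail R₁ H₁ tail-cost (WindowDone H)
          call-subroutine with proj₂ subroutine M X′ Y′ 1≤m X≤M Y≤M (X-monotone , Y-monotone)
            ⟨ 0 , arguments m M , view H₁ ⟩ prepared-input
          ... | t , s′ , run′ , t≤ , conv
            = seq {c = call P} (weaken {c = call P} (+-monoʳ-≤ (registers P + 4) (*-monoˡ-≤ 3 t≤)) returned
              (call-ends {P} (<⇒≤ (+< base≤X V≤X)) (<⇒≤ (+< E≤X V≤X)) (here-E R₁ here₁) (here-base R₁ here₁)
                (here-size R₁ here₁) (here-M R₁ here₁) U≤V (fresh fill) run′))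
            where
            open Answering stale fill {mem s′} conv
            open Answered {mem s′} conv using (Read; read-covered)
            open Simulation P W V E base (<⇒≤ (+< base≤X V≤X)) (<⇒≤ (+< E≤X V≤X))
            open Simulates

            U≤V : (m + M + 2) ^ w ≤ V
            U≤V = ≤-trans (^-monoˡ-≤ w (+-monoˡ-≤ 2 (+-monoˡ-≤ M m≤n)))
              (≤-trans (m≤n*m ((n + M + 2) ^ w) (n + M + 2) {{>-nonZero N>0}}) (≤-reflexive (sym V≡)))

            returned : ∀ {R₂ H₂} → Simulates R₁ H₁ s′ R₂ H₂ →
              Ends W (block rewind ⨾ while rGo (block fetch-answer) ⨾ block leave-window) R₂ H₂
                (cost rewind + (m * (2 + cost fetch-answer) + 1 + cost leave-window)) (WindowDone H)
            returned {R₂} {H₂} sim = seq {c = block rewind} (straight rewind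
              ( ≤-<-trans z≤n X<W , _ , here-lim R₂ here₂
              , seq {c = while rGo (block fetch-answer)} (weaken {c = while rGo (block fetch-answer)} ≤-refl finished
                  (while-count (Reading H₂) Reading.go≡ (λ F _ → reading-ends (cells sim) F) m record
                    { here = here₂ ; i≡ = refl ; go≡ = refl ; i+k≡m = refl
                    ; read = record
                      { good = good-low low₂ good ; improves = improves-low {H₂} (λ _ → refl)
                      ; high = λ _ → refl ; done = λ () } }))))
              where
              here₂ : Here R₂
              here₂ = here-frame {R₁} (own sim) here₁
              low₂ : ∀ {x} → x < base → H₂ x ≡ H x
              low₂ x< = trans (Simulates.low sim x<) (Filled.low fill x<)

              finished : ∀ {R₃ H₃} → R₃ rGo ≡ 0 × (∃[ k ] Reading H₂ k R₃ H₃) →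
                Ends W (block leave-window) R₃ H₃ (cost leave-window) (WindowDone H)
              finished {R₃} {H₃} (go0 , k , F)
                with ((eN , _) , _ , eHalf , _) , eB , eE ← Reading.here F = straight leave-window
                ( _ , cong₂ _+_ eB eHalf , +< β≤X h≤X
                , _ , cong (_∸ (β + h)) eN , tt
                , record
                  { local = proj₁ (Reading.here F) ; b≡ = refl ; E≡ = eE ; win≡ = refl
                  ; good = Read.good rd ; improves = improves-trans {H′ = H₂} (improves-low low₂) (Read.improves rd)
                  ; fresh = λ x → subst (_< E + V) (sym (Read.high rd x)) (Simulates.fresh sim x)
                  ; covered = read-covered rd } )
                where
                rd : Read H₂ m H₃
                rd = subst (λ k → Read H₂ k H₃) (trans (sym (+-identityʳ _))
                  (trans (cong (Reading.i F +_) (trans (sym go0) (Reading.go≡ F))) (Reading.i+k≡m F)))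
                  (Reading.read F)
                h≤X : h ≤ X
                h≤X = ≤-trans (⌈n/2⌉≤n m) m≤X

        rewind⇒ : ∀ {R′ H′} → R′ rGo ≡ 0 × (∃[ k′ ] Filling H k′ R′ H′) → Ends W tail R′ H′ tail-cost (WindowDone H)
        rewind⇒ {R′} {H′} (go0 , k′ , F) = Called.call-subroutine (here F)
          (subst (λ k → Filled H k H′) (trans (sym (+-identityʳ (i F)))
            (trans (cong (i F +_) (trans (sym go0) (go≡ F))) (i+k≡m F))) (filled F))

    record Windows (k : ℕ) (R H : Store) : Set where
      field
        {β E₀} : ℕ
        local  : Local R
        b≡     : R rB ≡ β
        E≡     : R rE ≡ E₀
        win≡   : R rWin ≡ n ∸ β
        good   : Good H
        fresh  : ∀ x → H (base + x) < E₀ + V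
        -- n V pays for the at most n windows of a smaller level, V for a
        -- remaining window of this one.
        epochs : E₀ + h * (n * V) + (n ∸ β) * V ≤ n * (n * V)
        count  : n ≤ β + k * h
        last   : ∀ {j} → j < n → Covered H top j
        -- Pairs with `i + m < n` are inherited from the larger levels, those with `j < β` come from
        -- the earlier windows of this level.
        done   : ∀ {i j} → i < n → j < n → i + h < n → i + m < n ⊎ j < β → Covered H i j

    1≤h : 1 ≤ h
    1≤h = ⌈n/2⌉-mono 1≤m

    windows-step : ∀ {k R H} → Windows (suc k) R H → R rWin ≢ 0 →
      Ends W window R H (window-cost (T₂ m M) m) (Windows k)
    windows-step {k} {R} {H} F win≢0 = weaken {c = window} ≤-refl next
      (window-ends (local F) (b≡ F) (E≡ F) (good F) (fresh F))
      where
      open Windows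
      remaining : 1 ≤ n ∸ β F
      remaining = n≢0⇒n>0 (λ eq → win≢0 (trans (win≡ F) eq))
      β<n : β F < n
      β<n = m∸n≢0⇒n<m (λ eq → win≢0 (trans (win≡ F) eq))
      -- As `h` is positive, a window shortens the remaining length by at least one, and this
      -- releases the `V` by which it advances the epoch.
      step≤ : V + (n ∸ (β F + h)) * V ≤ (n ∸ β F) * V
      step≤ = *-monoˡ-≤ V (subst (λ x → suc x ≤ n ∸ β F) (∸-+-assoc n (β F) h)
        (≤-trans (s≤s (∸-monoʳ-≤ (n ∸ β F) 1≤h)) (≤-reflexive (m+[n∸m]≡n remaining))))
      epochs′ : E₀ F + V + h * (n * V) + (n ∸ (β F + h)) * V ≤ n * (n * V)
      epochs′ = begin
        E₀ F + V + h * (n * V) + (n ∸ (β F + h)) * V   ≡⟨ cong (_+ (n ∸ (β F + h)) * V) (swap (E₀ F) V (h * (n * V))) ⟩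
        E₀ F + h * (n * V) + V + (n ∸ (β F + h)) * V   ≡⟨ +-assoc (E₀ F + h * (n * V)) V _ ⟩
        E₀ F + h * (n * V) + (V + (n ∸ (β F + h)) * V) ≤⟨ +-monoʳ-≤ (E₀ F + h * (n * V)) step≤ ⟩
        E₀ F + h * (n * V) + (n ∸ β F) * V             ≤⟨ epochs F ⟩
        n * (n * V)                                    ∎
        where
        open ≤-Reasoning
        swap : ∀ x y z → x + y + z ≡ x + z + y
        swap = solve-∀
      E₀+V≤X : E₀ F + V ≤ X
      E₀+V≤X = ≤-trans (m≤m+n _ (h * (n * V))) (≤-trans (≤-trans (m≤m+n _ _) epochs′) nnV≤X)

      open InWindow β<n E₀+V≤X

      next : ∀ {R′ H′} → WindowDone H R′ H′ → Windows k R′ H′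
      next {R′} {H′} D = record
        { local  = WindowDone.local D
        ; b≡     = WindowDone.b≡ D
        ; E≡     = WindowDone.E≡ D
        ; win≡   = WindowDone.win≡ D
        ; good   = WindowDone.good D
        ; fresh  = WindowDone.fresh D
        ; epochs = epochs′
        ; count  = ≤-trans (count F) (≤-reflexive (sym (+-assoc (β F) h (k * h))))
        ; last   = λ j<n → covered-improves {H} (∸1< 1≤n ≤-refl) j<n improves (last F j<n)
        ; done   = done′ }
        where
        open WindowDone D using (improves; covered)
        done′ : ∀ {i j} → i < n → j < n → i + h < n → i + m < n ⊎ j < β F + h → Covered H′ i j
        done′ {i} {j} i<n j<n i+h<n (inj₁ i+m<n) =
          covered-improves {H} i<n j<n improves (done F i<n j<n i+h<n (inj₁ i+m<n))
        done′ {i} {j} i<n j<n i+h<n (inj₂ j<β+h) with i + m <? n | j <? β F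
        ... | yes i+m<n | _       = covered-improves {H} i<n j<n improves (done F i<n j<n i+h<n (inj₁ i+m<n))
        ... | no _      | yes j<β = covered-improves {H} i<n j<n improves (done F i<n j<n i+h<n (inj₂ j<β))
        ... | no i+m≮n  | no j≮β  = covered i<n j<n n∸m≤i β≤j in-range
          where
          β≤j = ≮⇒≥ j≮β
          n∸m≤i : n ∸ m ≤ i
          n∸m≤i = m≤n+o⇒m∸n≤o n m (subst (n ≤_) (+-comm i m) (≮⇒≥ i+m≮n))
          -- Here the choice of the window distance pays off: `i + h < n` leaves an offset below
          -- `m ∸ h` in the first input, and the offset in the second is at most `h`.
          in-range : (i ∸ (n ∸ m)) + (j ∸ β F) < m
          in-range = ≤-<-trans (+-monoʳ-≤ (i ∸ (n ∸ m)) (m≤n+o⇒m∸n≤o j (β F) (<⇒≤ j<β+h)))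
            (+-cancelˡ-< (n ∸ m) _ _ (subst₂ _<_
              (trans (cong (_+ h) (sym (m+[n∸m]≡n n∸m≤i))) (+-assoc (n ∸ m) _ h)) (sym (m∸n+n≡m m≤n)) i+h<n))

  record Levels (m : ℕ) (R H : Store) : Set where
    field
      {E₀}   : ℕ
      global : Global R
      size≡  : R rSize ≡ m
      lev≡   : R rLev ≡ m ∸ 1
      E≡     : R rE ≡ E₀
      good   : Good H
      fresh  : ∀ x → H (base + x) < E₀ + V
      epochs : E₀ + m * (n * V) ≤ n * (n * V)
      last   : ∀ {j} → j < n → Covered H top j
      done   : ∀ {i j} → i < n → j < n → i + m < n → Covered H i j

  level-step : ∀ {m q R H} → 2 ≤ m → m ≤ n → n ≤ q * m → Levels m R H →
    Ends W level R H (level-cost q (T₂ m M) m) (Levels ⌈ m /2⌉)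
  level-step {suc zero} (s≤s ())
  level-step {m@(suc (suc m₀))} {q} {R} {H} 2≤m m≤n n≤qm F
    with (eN , eM , eOne , eV , eBase , eTop , eTop2 , eOut) ← Levels.global F =
    seq {c = block enter-level} (straight enter-level
      ( _ , cong₂ _+_ size≡ eOne , +< m≤X 1≤X
      , ≤-<-trans 2≤X X<W
      , _ , trans (/2≡⌊/2⌋ (m + 1)) (cong ⌊_/2⌋ (+-comm m 1)) , tt
      , _ , cong₂ _∸_ size≡ eOne , tt
      , _ , refl , +< m∸1≤X m∸1≤X
      , _ , cong₂ _∸_ eN size≡ , tt
      , _ , cong₂ _+_ eBase size≡ , +< base≤X m≤X
      , _ , cong (base + m +_) size≡ , +< base+m≤X m≤X
      , _ , size≡
      , ≤-<-trans z≤n X<W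
      , _ , eN
      , seq {c = while rWin window} (weaken {c = while rWin window} ≤-refl leave
          (while-count Windows stop windows-step (q * 2) record
            { local  = global , size≡ , refl , refl , refl , refl , refl , refl , refl
            ; b≡     = refl
            ; E≡     = E≡
            ; win≡   = refl
            ; good   = good
            ; fresh  = fresh
            ; epochs = epochs′
            ; count  = ≤-trans n≤qm (halving q m)
            ; last   = last
            ; done   = λ where
                i<n j<n _ (inj₁ i+m<n) → done i<n j<n i+m<n
                _   _   _ (inj₂ ()) }))))
    where
    open Levels F
    1≤m : 1 ≤ m
    1≤m = ≤-trans (s≤s z≤n) 2≤m
    open AtLevel 1≤m m≤n
    2≤X : 2 ≤ X
    2≤X = ≤-trans (m≤n+m 2 (n + M)) N≤X
    m∸1≤X : m ∸ 1 ≤ X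
    m∸1≤X = ≤-trans (m∸n≤m m 1) m≤X
    base+m≤X : base + m ≤ X
    base+m≤X = ≤-trans (≤-trans (+-monoʳ-≤ base m≤n) (m≤m+n (base + n) n)) base+n≤X
    -- Since `⌈ m /2⌉ < m`, passing to the next level frees a share `n * V`, enough for the at most
    -- `n` windows of the current one.
    epochs′ : E₀ + h * (n * V) + n * V ≤ n * (n * V)
    epochs′ = ≤-trans (≤-reflexive (trans (+-assoc E₀ _ _) (cong (E₀ +_) (+-comm (h * (n * V)) (n * V)))))
      (≤-trans (+-monoʳ-≤ E₀ (*-monoˡ-≤ (n * V) (⌈n/2⌉<n m₀))) epochs)
    stop : ∀ {R H} → Windows 0 R H → R rWin ≡ 0
    stop D = trans (Windows.win≡ D) (m≤n⇒m∸n≡0 (subst (n ≤_) (+-identityʳ _) (Windows.count D)))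
    leave : ∀ {R′ H′} → R′ rWin ≡ 0 × (∃[ k ] Windows k R′ H′) →
      Ends W (block leave-level) R′ H′ (cost leave-level) (Levels h)
    leave (win0 , k , D) with ((_ , _ , eOne , _) , _ , eHalf , _) ← Windows.local D = straight leave-level
      ( _ , eHalf , _ , cong (h ∸_) eOne , tt , record
        { global = proj₁ (Windows.local D)
        ; size≡  = refl
        ; lev≡   = refl
        ; E≡     = Windows.E≡ D
        ; good   = Windows.good D
        ; fresh  = Windows.fresh D
        ; epochs = ≤-trans (m≤m+n _ _) (Windows.epochs D)
        ; last   = Windows.last D
        ; done   = λ i<n j<n i+h<n → Windows.done D i<n j<n i+h<n
            (inj₂ (<-≤-trans j<n (m∸n≡0⇒m≤n (trans (sym (Windows.win≡ D)) win0)))) } )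

  N : ℕ
  N = n + M + 2

  module _ {c : ℕ} (1≤c : 1 ≤ c)
    (level-≤ : ∀ {m q} → 2 ≤ m → 1 ≤ q → 2 + level-cost q (T₂ m M) m ≤ q * (c * T₂ m M)) where

    -- All `q` subproblems of one depth of the recursion are treated at once. The loop round is
    -- charged to their `q` terms `c * T₂`, the remaining levels to the `q * 2` subproblems of half
    -- the size.
    levels-ends : ∀ f {m q R H} → m ≤ f → 1 ≤ m → m ≤ n → n ≤ q * m → 1 ≤ q → Levels m R H →
      Ends W (while rLev level) R H (q * time c T₂ f m M) Solved
    levels-ends (suc f) {1} {q} {H = H} m≤f 1≤m m≤n n≤qm 1≤q F =
      weaken {c = while rLev level} (*-mono-≤ 1≤q 1≤c) (λ φ → φ)
        (while-zero {c = level} (Levels.lev≡ F) (Levels.good F , λ i<n j<n → cover i<n j<n))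
      where
      cover : ∀ {i j} → i < n → j < n → Covered H i j
      cover {i} {j} i<n j<n with i + 1 <? n
      ... | yes i+1<n = Levels.done F i<n j<n i+1<n
      ... | no i+1≮n  = subst (λ i → Covered H i j) (≤-antisym
        (≤-trans (∸-monoˡ-≤ 1 (≮⇒≥ i+1≮n)) (≤-reflexive (m+n∸n≡m i 1))) (≤∸1 i<n)) (Levels.last F j<n)
    levels-ends (suc f) {suc (suc m)} {q} m≤f 1≤m m≤n n≤qm 1≤q F =
      weaken {c = while rLev level} budget (λ φ → φ)
        (while-suc {c = level} (λ eq → contradiction (trans (sym (Levels.lev≡ F)) eq) (λ ()))
          (weaken {c = level} ≤-refl
            (levels-ends f {q = q * 2} (⌈/2⌉-fuel m≤f) (⌈n/2⌉-mono 1≤m) (≤-trans (⌈n/2⌉≤n (suc (suc m))) m≤n)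
              (≤-trans n≤qm (halving q (suc (suc m)))) (≤-trans 1≤q (m≤m*n q 2)))
            (level-step {q = q} (s≤s (s≤s z≤n)) m≤n n≤qm F)))
      where
      t = time c T₂ f ⌈ suc (suc m) /2⌉ M
      budget : 2 + level-cost q (T₂ (suc (suc m)) M) (suc (suc m)) + q * 2 * t ≤ q * (2 * t + c * T₂ (suc (suc m)) M)
      budget = begin
        2 + level-cost q (T₂ (suc (suc m)) M) (suc (suc m)) + q * 2 * t
          ≤⟨ +-mono-≤ (level-≤ (s≤s (s≤s z≤n)) 1≤q) (≤-reflexive (*-assoc q 2 t)) ⟩
        q * (c * T₂ (suc (suc m)) M) + q * (2 * t) ≡⟨ +-comm (q * (c * T₂ (suc (suc m)) M)) _ ⟩
        q * (2 * t) + q * (c * T₂ (suc (suc m)) M) ≡⟨ *-distribˡ-+ q (2 * t) _ ⟨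
        q * (2 * t + c * T₂ (suc (suc m)) M)       ∎
        where open ≤-Reasoning

    wp-power : ∀ k {j R H} {Φ : Assertion} → R rX ≡ N → R rV ≡ N ^ j → j + k ≡ suc w →
      (∀ R′ → (∀ {r} → r ≢ rV → R′ r ≡ R r) → R′ rV ≡ V → Φ R′ H) →
      wp W (replicate k (bin mul rV rX rV)) Φ R H
    wp-power zero {j} {R} eX eV j≡ φ = φ R (λ _ → refl)
      (trans eV (trans (cong (N ^_) (trans (sym (+-identityʳ j)) j≡)) (sym V≡)))
    wp-power (suc k) {j} {R} {Φ = Φ} eX eV j≡ φ =
      N ^ suc j , cong₂ _*_ eX eV , power< ,
      wp-power k {suc j} {Φ = Φ} eX refl j+k≡ (λ R′ own e → φ R′ (λ r≢ → trans (own r≢) (≔-other R r≢)) e)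
      where
      j+k≡ : suc j + k ≡ suc w
      j+k≡ = trans (sym (+-suc j k)) j≡
      power< : N ^ suc j < W
      power< = ≤-<-trans (≤-trans (^-monoʳ-≤ N {{>-nonZero N>0}} (subst (suc j ≤_) j+k≡ (m≤m+n (suc j) k)))
        (≤-reflexive (sym V≡))) (≤-<-trans V≤X X<W)

    record Starting (k : ℕ) (R H : Store) : Set where
      field
        {i}     : ℕ
        global  : Global R
        lim≡    : R rLim ≡ top + top + 1
        i≡      : R rI ≡ i
        go≡     : R rGo ≡ k
        i+k≡    : i + k ≡ top + top + 1
        E≡      : R rE ≡ 0
        started : Started i H

    open Starting

    start-ends : ∀ {k R H} → Starting (suc k) R H → Ends W (block start) R H (cost start) (Starting k)
    start-ends {k} {R} {H} F
      with (eN , eM , eOne , eV , eBase , eTop , eTop2 , eOut) ← global F = straight start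
        ( λ _ → refl
        , _ , cong₂ clip (i≡ F) eTop
        , _ , cong (λ t → mirror ρ t (clip (i F) top)) eTop
        , _ , Started.input (started F) a<
        , _ , cong₂ _∸_ (i≡ F) eTop , tt
        , _ , cong (λ t → mirror ρ t (i F ∸ top)) eTop
        , _ , cong (_+ mirror ρ top (i F ∸ top)) eN , +< n≤X (≤-trans (mirror-≤ ρ i∸top≤) top≤X)
        , _ , Started.input (started F) b<
        , _ , refl , +< (≤-trans (H₀≤M a<) M≤X) (≤-trans (H₀≤M b<) M≤X)
        , _ , cong₂ (mirror ρ) eTop2 (i≡ F)
        , _ , cong (_+ mirror ρ (top + top) (i F)) eOut , +< out≤X (≤-trans (mirror-≤ ρ i≤) top+top≤X)
        , _ , _ , refl , refl
        , _ , suc-i , subst (_< W) (+-comm (i F) 1) (+< (≤-trans i≤ top+top≤X) 1≤X)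
        , _ , cong (_∸ suc (i F)) (lim≡ F) , tt
        , record
          { global  = global F
          ; lim≡    = lim≡ F
          ; i≡      = refl
          ; go≡     = trans (cong (_∸ suc (i F)) (sym i+k≡′)) (m+n∸m≡n (suc (i F)) k)
          ; i+k≡    = i+k≡′
          ; E≡      = E≡ F
          ; started = started-≔ i≤ refl refl (started F) } )
      where
      i+k≡′ : suc (i F) + k ≡ top + top + 1
      i+k≡′ = trans (sym (+-suc (i F) k)) (i+k≡ F)
      i≤ : i F ≤ top + top
      i≤ = ≤-pred (subst (suc (i F) ≤_) (trans i+k≡′ (+-comm (top + top) 1)) (m≤m+n _ k))
      i∸top≤ : i F ∸ top ≤ top
      i∸top≤ = m≤n+o⇒m∸n≤o (i F) top i≤
      a< : mirror ρ top (clip (i F) top) < n + n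
      a< = <-≤-trans (mirror-< ρ (∸1< 1≤n (clip-≤ʳ (i F) top))) (m≤m+n n n)
      b< : n + mirror ρ top (i F ∸ top) < n + n
      b< = +-monoʳ-< n (mirror-< ρ (∸1< 1≤n i∸top≤))
      suc-i : R rI + R rOne ≡ suc (i F)
      suc-i = trans (cong₂ _+_ (i≡ F) eOne) (+-comm (i F) 1)

    body-cost : ℕ
    body-cost = cost power + (cost setup + ((top + top + 1) * (2 + cost start) + 1 +
      (cost enter-levels + 1 * time c T₂ n n M)))

    body-ends : ∀ {R} → R rN ≡ n → R rM ≡ M → R rE ≡ 0 → Ends W body R H₀ body-cost Solved
    body-ends {R} eN eM eE = seq {c = block power} (straight power
      ( _ , cong₂ _+_ eN eM , ≤-<-trans (≤-trans (m≤m+n _ 2) N≤X) X<W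
      , ≤-<-trans (≤-trans (m≤n+m 2 (n + M)) N≤X) X<W
      , _ , refl , ≤-<-trans N≤X X<W
      , ≤-<-trans 1≤X X<W
      , wp-power (suc w) {0} refl refl refl λ R′ own eV → after-power
          (trans (own λ ()) eN) (trans (own λ ()) eM) (trans (own λ ()) eE) eV))
      where
      after-start : ∀ {R H} → R rGo ≡ 0 × (∃[ k ] Starting k R H) →
        Ends W (block enter-levels ⨾ while rLev level) R H (cost enter-levels + 1 * time c T₂ n n M) Solved
      after-start {R} {H} (go0 , k , F)
        with (eN , eM , eOne , _) ← global F = seq {c = block enter-levels} (straight enter-levels
          ( _ , eN
          , _ , cong (n ∸_) eOne , tt
          , levels-ends n ≤-refl 1≤n ≤-refl (≤-reflexive (sym (+-identityʳ n))) ≤-refl record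
            { global = global F
            ; size≡  = refl
            ; lev≡   = refl
            ; E≡     = E≡ F
            ; good   = started-good st
            ; fresh  = λ x → subst (_< V) (sym (trans (Started.rest st (m≤m+n base x))
                (H₀-rest (≤-trans (m≤m+n out out) (m≤m+n base x))))) (≤-<-trans z≤n M<V)
            ; epochs = ≤-refl
            ; last   = started-covered st
            ; done   = λ _ _ i+n<n → contradiction i+n<n (≤⇒≯ (m≤n+m n _)) } ))
        where
        st : Started (suc (top + top)) H
        st = subst (λ i → Started i H) (trans (sym (+-identityʳ (i F)))
          (trans (cong (i F +_) (trans (sym go0) (go≡ F))) (trans (i+k≡ F) (+-comm (top + top) 1)))) (started F)

      after-power : ∀ {R} → R rN ≡ n → R rM ≡ M → R rE ≡ 0 → R rV ≡ V →
        Ends W (block setup ⨾ while rGo (block start) ⨾ block enter-levels ⨾ while rLev level) R H₀ _ Solved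
      after-power {R} eN eM eE eV = seq {c = block setup} (straight setup
        ( ≤-<-trans 1≤X X<W
        , _ , cong₂ _+_ eN eN , +< n≤X n≤X
        , _ , refl , +< out≤X out≤X
        , _ , cong (_∸ 1) eN , tt
        , _ , refl , +< top≤X top≤X
        , _ , refl , +< top+top≤X 1≤X
        , ≤-<-trans z≤n X<W
        , _ , refl
        , seq {c = while rGo (block start)} (weaken {c = while rGo (block start)} ≤-refl after-start
            (while-count Starting go≡ (λ F _ → start-ends F) (top + top + 1) record
              { global  = eN , eM , refl , eV , refl , refl , refl , refl
              ; lim≡    = refl
              ; i≡      = refl
              ; go≡     = refl
              ; i+k≡    = refl
              ; E≡      = eE
              ; started = record { input = λ _ → refl ; rest = λ _ → refl ; first = λ () } }))))

    program-ends : ∀ {R} → R rN ≡ n → R rM ≡ M → R rE ≡ 0 →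
      Ends W program R H₀ (2 + (2 + (body-cost + 1) + 1)) Solved
    program-ends eN eM eE = seq {c = block (copy rMain rM ∷ [])} (straight (copy rMain rM ∷ [])
      ( _ , eM
      , while-suc {c = body ⨾ block (set rMain 0 ∷ [])} (λ M≡0 → <⇒≢ 1≤M (sym M≡0))
          (seq {c = body} (weaken {c = body} ≤-refl
            (λ solved → straight (set rMain 0 ∷ [])
              (≤-<-trans z≤n X<W , while-zero {c = body ⨾ block (set rMain 0 ∷ [])} refl solved))
            (body-ends eN eM eE)))))

-- Work outside the levels occurs once and is charged to the root of the recurrence: to its constant
-- if `n` is 1, and to its `T₂` term otherwise.
time-absorb : ∀ c c′ T n M → 1 ≤ n →
  (n ≡ 1 → time c T n n M + c′ ≤ time (c + c′) T n n M) ×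
  (2 ≤ n → time c T n n M + c′ * T n M ≤ time (c + c′) T n n M)
time-absorb c c′ T 1 M _ = (λ _ → ≤-refl) , λ where (s≤s ())
time-absorb c c′ T n@(suc (suc m)) M _ = (λ ()) , λ _ → begin
  2 * t + c * T n M + c′ * T n M   ≡⟨ +-assoc (2 * t) (c * T n M) _ ⟩
  2 * t + (c * T n M + c′ * T n M) ≡⟨ cong (2 * t +_) (*-distribʳ-+ (T n M) c c′) ⟨
  2 * t + (c + c′) * T n M         ≤⟨ +-monoˡ-≤ _ (*-monoʳ-≤ 2 half≤) ⟩
  time (c + c′) T n n M            ∎
  where
  open ≤-Reasoning
  t = time c T (suc m) ⌈ n /2⌉ M
  half≤ : t ≤ time (c + c′) T (suc m) ⌈ n /2⌉ M
  half≤ = time-mono T (suc m) ⌈ n /2⌉ M (m≤m+n c c′)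

-- Running time

module Linear (t : ℕ) (1≤t : 1 ≤ t) where

  infix 4 _⊑_

  -- Linear bounds in the unit `t`. The wrapper keeps the coefficient `k` visible to unification, so
  -- that a bound is assembled along the shape of a cost expression.
  record _⊑_ (x k : ℕ) : Set where
    constructor scaled
    field
      ⊑⇒≤ : x ≤ k * t

  open _⊑_ public

  constant : ∀ k → k ⊑ k
  constant k = scaled (m≤m*n k t {{>-nonZero 1≤t}})

  plus : ∀ {x y k l} → x ⊑ k → y ⊑ l → x + y ⊑ k + l
  plus {k = k} {l} (scaled x≤) (scaled y≤) =
    scaled (≤-trans (+-mono-≤ x≤ y≤) (≤-reflexive (sym (*-distribʳ-+ t k l))))

  times : ∀ {x} k → x ≤ t → x * k ⊑ k
  times {x} k x≤t = scaled (≤-trans (≤-reflexive (*-comm x k)) (*-monoʳ-≤ k x≤t))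

module Costs (o : Extremum) (d : Direction) (P : Program) (w : ℕ) where

  open Text o (reversal o d) P (suc w)

  -- `window-cost` with `t` and `m` both replaced by 1.
  window-constant : ℕ
  window-constant = cost enter-window + ((2 + cost fill) + 1 + (registers P + 4 + 3 +
    (cost rewind + ((2 + cost fetch-answer) + 1 + cost leave-window))))

  window-cost-≤ : ∀ {t m} → 1 ≤ t → m ≤ t → window-cost t m ≤ window-constant * t
  window-cost-≤ {t} {m} 1≤t m≤t = ⊑⇒≤ (plus (constant (cost enter-window))
    (plus (plus (times (2 + cost fill) m≤t) (constant 1))
      (plus (plus (constant (registers P + 4)) (times 3 ≤-refl))
        (plus (constant (cost rewind))
          (plus (plus (times (2 + cost fetch-answer) m≤t) (constant 1)) (constant (cost leave-window)))))))
    where open Linear t 1≤t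

  level-constant : ℕ
  level-constant = 2 + (cost enter-level + (2 * (2 + window-constant) + 1 + cost leave-level))

  level-cost-≤ : ∀ {q t m} → 1 ≤ q → 1 ≤ t → m ≤ t → 2 + level-cost q t m ≤ q * (level-constant * t)
  level-cost-≤ {q} {t} {m} 1≤q 1≤t m≤t = ≤-trans
    (⊑⇒≤ (plus (constant 2) (plus (constant (cost enter-level))
      (plus (plus (scaled {k = 2 * (2 + window-constant)} windows) (constant 1)) (constant (cost leave-level))))))
    (≤-reflexive (exchange level-constant q t))
    where
    open Linear (q * t) (*-mono-≤ 1≤q 1≤t)
    exchange : ∀ k q t → k * (q * t) ≡ q * (k * t)
    exchange = solve-∀
    regroup : ∀ q k t → q * 2 * (k * t) ≡ 2 * k * (q * t)
    regroup = solve-∀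
    windows : q * 2 * (2 + window-cost t m) ≤ 2 * (2 + window-constant) * (q * t)
    windows = ≤-trans
      (*-monoʳ-≤ (q * 2) (Linear.⊑⇒≤ (Linear.plus t 1≤t (Linear.constant t 1≤t 2)
        (Linear.scaled {k = window-constant} (window-cost-≤ 1≤t m≤t)))))
      (≤-reflexive (regroup q (2 + window-constant) t))

  start-constant : ℕ
  start-constant = 2 + (2 + (cost power + (cost setup + ((2 + cost start) + 1 + cost enter-levels)) + 1) + 1)

  program-cost-≤ : ∀ {l u} → 1 ≤ u → l ≤ u → ∀ s →
    2 + (2 + (cost power + (cost setup + (l * (2 + cost start) + 1 + (cost enter-levels + 1 * s))) + 1) + 1)
      ≤ s + start-constant * u
  program-cost-≤ {l} {u} 1≤u l≤u s = ≤-trans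
    (≤-reflexive (regroup (cost power) (cost setup) (l * (2 + cost start)) (cost enter-levels) s))
    (+-monoʳ-≤ s (⊑⇒≤ (plus (constant 2) (plus (plus (constant 2) (plus
      (plus (constant (cost power)) (plus (constant (cost setup))
        (plus (plus (times (2 + cost start) l≤u) (constant 1)) (constant (cost enter-levels)))))
      (constant 1))) (constant 1)))))
    where
    open Linear u 1≤u
    regroup : ∀ a b x c s → 2 + (2 + (a + (b + (x + 1 + (c + 1 * s))) + 1) + 1) ≡
      s + (2 + (2 + (a + (b + (x + 1 + c)) + 1) + 1))
    regroup = solve-∀

-- Since `N ≥ 2` gives `8 ≤ N ^ 3`, the sum `X` is at most `2 * N ^ 3 * V`. Its double is at most
-- `4 * N ^ 3 * V`, hence at most `N ^ 5 * V`; one more factor `N` makes the bound strict, and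
-- `V = N ^ suc w` yields the exponent `7 + w`.
word-bound : ∀ {n M} w → let N = n + M + 2 ; V = N ^ suc w
                             X = (n + n) + (n + n) + n + n + N + V + n * (n * V) in
  X + X < N ^ (7 + w)
word-bound {n} {M} w = begin-strict
  X + X                         ≡⟨ cong (X +_) (+-identityʳ X) ⟨
  2 * X                         ≤⟨ *-monoʳ-≤ 2 X≤ ⟩
  2 * (8 * V + N * (N * V))     ≤⟨ *-monoʳ-≤ 2 (+-mono-≤ 8V≤ NNV≤) ⟩
  2 * (N * N * N * V + N * N * N * V) ≡⟨ double (N * N * N * V) ⟩
  4 * (N * N * N * V)           ≤⟨ *-monoˡ-≤ (N * N * N * V) (*-mono-≤ 2≤N 2≤N) ⟩
  N * N * (N * N * N * V)       <⟨ m<m*n (N * N * (N * N * N * V)) N {{nonzero}} 2≤N ⟩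
  N * N * (N * N * N * V) * N   ≡⟨ collect N V ⟩
  N ^ (7 + w)                   ∎
  where
  open ≤-Reasoning
  N = n + M + 2
  V = N ^ suc w
  X = (n + n) + (n + n) + n + n + N + V + n * (n * V)
  2≤N : 2 ≤ N
  2≤N = m≤n+m 2 (n + M)
  instance
    N≢0 : NonZero N
    N≢0 = >-nonZero (≤-trans (s≤s z≤n) 2≤N)
    V≢0 : NonZero V
    V≢0 = m^n≢0 N (suc w)
  nonzero : NonZero (N * N * (N * N * N * V))
  nonzero = >-nonZero (*-mono-≤ {1} {N * N} {1} (*-mono-≤ 1≤N 1≤N)
    (*-mono-≤ (*-mono-≤ (*-mono-≤ 1≤N 1≤N) 1≤N) (>-nonZero⁻¹ V)))
    where
    1≤N : 1 ≤ N
    1≤N = ≤-trans (s≤s z≤n) 2≤N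
  double : ∀ y → 2 * (y + y) ≡ 4 * y
  double = solve-∀
  collect : ∀ N V → N * N * (N * N * N * V) * N ≡ N * (N * (N * (N * (N * (N * V)))))
  collect = solve-∀
  n≤V : n ≤ V
  n≤V = ≤-trans (≤-trans (m≤m+n n M) (m≤m+n (n + M) 2)) (m≤m*n N (N ^ w) {{m^n≢0 N w}})
  six : ∀ n → n + n + (n + n) + n + n ≡ 6 * n
  six = solve-∀
  eight : ∀ V → 6 * V + V + V ≡ 8 * V
  eight = solve-∀
  X≤ : X ≤ 8 * V + N * (N * V)
  X≤ = +-mono-≤
    (≤-trans (+-monoˡ-≤ V (+-mono-≤
        (≤-trans (≤-reflexive (six n)) (*-monoʳ-≤ 6 n≤V)) (m≤m*n N (N ^ w) {{m^n≢0 N w}})))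
      (≤-reflexive (eight V)))
    (*-mono-≤ n≤N (*-monoˡ-≤ V n≤N))
    where
    n≤N : n ≤ N
    n≤N = ≤-trans (m≤m+n n M) (m≤m+n (n + M) 2)
  8V≤ : 8 * V ≤ N * N * N * V
  8V≤ = *-monoˡ-≤ V (*-mono-≤ (*-mono-≤ 2≤N 2≤N) 2≤N)
  NNV≤ : N * (N * V) ≤ N * N * N * V
  NNV≤ = ≤-trans (≤-reflexive (sym (*-assoc N N V))) (*-monoˡ-≤ V (m≤m*n (N * N) N))

-- The algorithm and its running time

module Algorithm (o : Extremum) (d : Direction) (T₂ : ℕ → ℕ → ℕ) (P : Program)
  (subroutine : ComputesInTime o (λ A B → Monotone d A × Monotone d B) T₂ P) where

  w = proj₁ subroutine

  open Text o (reversal o d) P (suc w)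
  open Costs o d P w

  c : ℕ
  c = level-constant + start-constant

  T₁ : ℕ → ℕ → ℕ
  T₁ n M = time c T₂ n n M

  T₁-1 : ∀ M → T₁ 1 M ≤ c
  T₁-1 M = ≤-refl

  T₁-recurrence : ∀ n M → 2 ≤ n → T₁ n M ≤ 2 * T₁ ⌈ n /2⌉ M + c * T₂ n M
  T₁-recurrence (suc zero)    M (s≤s ())
  T₁-recurrence (suc (suc m)) M _ = ≤-reflexive
    (cong (λ t → 2 * t + c * T₂ (suc (suc m)) M) (time-fuel c T₂ _ M (⌈/2⌉-fuel {m} ≤-refl) ≤-refl))

  module _ {n : ℕ} (M : ℕ) (A B : Vector ℕ n) (1≤n : 1 ≤ n) (A≤M : ∀ i → A i ≤ M) (B≤M : ∀ j → B j ≤ M)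
    (A-monotone : Monotone d A) {R H₀ : Store} (input : Input M A B ⟨ 0 , R , H₀ ⟩) where

    open Input input
    open Problem o (reversal o d) 1≤n H₀

    N V X W : ℕ
    N = n + M + 2
    V = N ^ suc w
    X = (n + n) + (n + n) + n + n + N + V + n * (n * V)
    W = N ^ (7 + w)

    H₀≡A : ∀ {x} (x<n : x < n) → H₀ x ≡ A (fromℕ< x<n)
    H₀≡A x<n = trans (cong H₀ (sym (toℕ-fromℕ< x<n))) (mem-A (fromℕ< x<n))

    H₀≤M : ∀ {x} → x < n + n → H₀ x ≤ M
    H₀≤M {x} x<n+n with x <? n
    ... | yes x<n = subst (_≤ M) (sym (H₀≡A x<n)) (A≤M (fromℕ< x<n))
    ... | no x≮n  = subst (_≤ M) (sym H₀≡B) (B≤M (fromℕ< y<n))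
      where
      n≤x = ≮⇒≥ x≮n
      y<n : x ∸ n < n
      y<n = +-cancelˡ-< n _ _ (subst (_< n + n) (sym (m+[n∸m]≡n n≤x)) x<n+n)
      H₀≡B : H₀ x ≡ B (fromℕ< y<n)
      H₀≡B = trans (cong H₀ (trans (sym (m+[n∸m]≡n n≤x)) (cong (n +_) (sym (toℕ-fromℕ< y<n))))) (mem-B (fromℕ< y<n))

    H₀-rest : ∀ {x} → n + n ≤ x → H₀ x ≡ 0
    H₀-rest {x} ≤x = mem-rest x (subst (_≤ x) (cong (n +_) (sym (+-identityʳ n))) ≤x)

    H₀-all : ∀ x → H₀ x ≤ M
    H₀-all x with x <? n + n
    ... | yes x< = H₀≤M x<
    ... | no x≮  = subst (_≤ M) (sym (H₀-rest (≮⇒≥ x≮))) z≤n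

    N<W : N < W
    N<W = ≤-<-trans (≤-trans (m≤n+m N ((n + n) + (n + n) + n + n)) (≤-trans (m≤m+n _ V) (m≤m+n _ (n * (n * V)))))
      (≤-<-trans (m≤m+n X X) (word-bound {n} {M} w))

    M<W : M < W
    M<W = ≤-<-trans (≤-trans (m≤n+m M n) (m≤m+n (n + M) 2)) N<W

    fits : Fits W ⟨ 0 , R , H₀ ⟩
    fits = registers-fit , λ x → ≤-<-trans (H₀-all x) M<W
      where
      registers-fit : ∀ r → R r < W
      registers-fit 0 = subst (_< W) (sym reg-n) (≤-<-trans (≤-trans (m≤m+n n M) (m≤m+n (n + M) 2)) N<W)
      registers-fit 1 = subst (_< W) (sym reg-M) M<W
      registers-fit r@(suc (suc _)) = subst (_< W) (sym (reg-rest r (s≤s (s≤s z≤n)))) (≤-<-trans z≤n N<W)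

    a-improving : Improving o n a
    a-improving = ordered⇒improving o d (monotone⇒ordered d {f = H₀} mem-A A-monotone)

    -- For M = 0 the zero-initialised output is already correct, and T₂ n 0 may
    -- be too small to pay for anything else.
    ends-0 : M ≡ 0 → Ends W program R H₀ 3 Solved
    ends-0 refl = seq {c = block (copy rMain rM ∷ [])} (straight (copy rMain rM ∷ [])
      (_ , reg-M , while-zero {c = body ⨾ block (set rMain 0 ∷ [])} refl (good , λ i<n j<n → covered)))
      where
      zeros : ∀ x → H₀ x ≡ 0
      zeros x = n≤0⇒n≡0 (H₀-all x)
      good : Good H₀
      good = started-good record { input = λ _ → refl ; rest = λ _ → refl
        ; first = λ _ → trans (zeros _) (sym (cong₂ _+_ (zeros _) (zeros _))) }
      covered : ∀ {i j} → Covered H₀ i j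
      covered {i} {j} = subst₂ (Dominates o) (sym (zeros _)) (sym (cong₂ _+_ (zeros _) (zeros _))) (dom-refl o)

    solved : Ends W program R H₀ (T₁ n M) Solved
    solved with M ≟ 0
    ... | yes M≡0 = weaken {c = program} (≤-trans (s≤s (s≤s (s≤s z≤n))) (time-≥c c T₂ n n M)) (λ φ → φ) (ends-0 M≡0)
    ... | no M≢0  = weaken {c = program} budget (λ φ → φ)
      (program-ends {level-constant} (s≤s z≤n) (λ 2≤m 1≤q →
          level-cost-≤ 1≤q (time≥1 (≤-trans (s≤s z≤n) 2≤m)) (time≥ (≤-trans (s≤s z≤n) 2≤m)))
        reg-n reg-M (reg-rest rE (s≤s (s≤s z≤n))))
      where
      1≤M : 1 ≤ M
      1≤M = n≢0⇒n>0 M≢0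
      open Correct o d T₂ P subroutine 1≤n 1≤M H₀ H₀≤M H₀-rest a-improving V X W refl
        (≤-trans (m≤m+n _ N) (≤-trans (m≤m+n _ V) (m≤m+n _ (n * (n * V)))))
        (≤-trans (m≤n+m N ((n + n) + (n + n) + n + n)) (≤-trans (m≤m+n _ V) (m≤m+n _ (n * (n * V)))))
        (≤-trans (m≤n+m V _) (m≤m+n _ (n * (n * V))))
        (m≤n+m (n * (n * V)) _)
        (word-bound {n} {M} w)
      time≥′ : ∀ {m} → 1 ≤ m → 2 * m ∸ 1 ≤ T₂ m M
      time≥′ {m} 1≤m = time-≥ subroutine m M 1≤m 1≤M
      time≥ : ∀ {m} → 1 ≤ m → m ≤ T₂ m M
      time≥ {suc m} 1≤m = ≤-trans (≤-trans (s≤s (m≤m+n m _)) (≤-reflexive (sym (+-suc m _)))) (time≥′ 1≤m)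
      time≥1 : ∀ {m} → 1 ≤ m → 1 ≤ T₂ m M
      time≥1 1≤m = ≤-trans 1≤m (time≥ 1≤m)
      s = time level-constant T₂ n n M
      budget : _ ≤ T₁ n M
      budget with n ≟ 1
      -- For `n = 1` the recurrence offers only its constant. Then the output has a single entry, so
      -- the overhead is bounded by a constant as well and the unit of cost is 1 instead of
      -- `T₂ n M`.
      ... | yes refl = ≤-trans (program-cost-≤ {1} {1} ≤-refl ≤-refl s)
        (≤-trans (+-monoʳ-≤ s (≤-reflexive (*-identityʳ start-constant)))
          (proj₁ (time-absorb level-constant start-constant T₂ n M 1≤n) refl))
      ... | no n≢1 = ≤-trans (program-cost-≤ {top + top + 1} {T₂ n M} (time≥1 1≤n)
          (≤-trans (≤-trans (≤-reflexive (+-comm (top + top) 1)) (2*∸1 n 1≤n ≤-refl)) (time≥′ 1≤n)) s)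
        (proj₂ (time-absorb level-constant start-constant T₂ n M 1≤n) (≤∧≢⇒< 1≤n (λ eq → n≢1 (sym eq))))

    solves : ∃₂ λ t s′ → Run (program 0) W ⟨ 0 , R , H₀ ⟩ t s′ × t ≤ T₁ n M × IsConvolution o A B (output n s′)
    solves with run solved fits
    ... | t , R′ , H′ , t≤ , path , fits′ , good , covered =
      t , _ , path-run (path (program 0) 0 (placed (λ eq → eq))) fits′ (fetch-length (program 0)) , t≤ ,
      λ k → let (i , j , i+j≡k , eq) , dominates = finish {H′} good covered k in
        (i , j , i+j≡k , trans (cong₂ _+_ (sym (mem-A i)) (sym (mem-B j))) eq) ,
        λ i j i+j≡k → subst (Dominates o _) (cong₂ _+_ (mem-A i) (mem-B j)) (dominates i j i+j≡k)

  computes : ComputesInTime o (λ A B → Monotone d A) T₁ (program 0)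
  computes = 7 + w , solve
    where
    solve : ∀ {n} M (A B : Vector ℕ n) → 1 ≤ n → (∀ i → A i ≤ M) → (∀ j → B j ≤ M) → Monotone d A →
      ∀ s → Input M A B s → ∃₂ λ t s′ → Run (program 0) ((n + M + 2) ^ (7 + w)) s t s′ × t ≤ T₁ n M ×
        IsConvolution o A B (output n s′)
    solve M A B 1≤n A≤M B≤M mono ⟨ p , R , H ⟩ input with refl ← Input.pc-start input =
      solves M A B 1≤n A≤M B≤M mono input

theorem8 : (o : Extremum) (d : Direction) (T₂ : ℕ → ℕ → ℕ) →
    (∀ m n M → m ≤ n → T₂ m M ≤ T₂ n M) →
    (∃[ P ] ComputesInTime o (λ A B → Monotone d A × Monotone d B) T₂ P) →
    ∃[ T₁ ] (∃[ Q ] ComputesInTime o (λ A B → Monotone d A) T₁ Q) ×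
    (∃[ c ] (∀ M → T₁ 1 M ≤ c) ×
    (∀ n M → 2 ≤ n → T₁ n M ≤ 2 * T₁ ⌈ n /2⌉ M + c * T₂ n M))
theorem8 o d T₂ _ (P , subroutine) = T₁ , (program 0 , computes) , c , T₁-1 , T₁-recurrence
  where
  open Algorithm o d T₂ P subroutine
  open Text o (reversal o d) P (suc w)
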